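{- Let $R$ be a rule set in which pairs of types $THTH$ and $HTHT$ both nest and pairs of types $HTTH$ and $THHT$ both cross, and let $\Delta_n=\Delta_n(R)$, $n\ge 0$ (assumed to be triangulations of $\partial P_n$ for $n\ge1$). Then the generating function of saturated faces satisfies $$F(\widehat{\mathcal F},x,y,z)=1+\sum_{a,b\ge0}\bigl(xD_{a,b}(x)+yD_{a,b}(y)\bigr)z^{a+b+1}+xy\sum_{a',b',a'',b''\ge0}D_{a',b'}(x)\,D_{a'',b''}(y)\,z^{a'+b'+a''+b''+2}\,C(a',b',a'',b'',z),$$ where $$C(a',b',a'',b'',z)=\binom{a'+b''+2}{a'+1}\binom{a''+b'+2}{b'+1}z+\binom{a'+b''+1}{b''}\binom{a''+b'+1}{b'}+\binom{a'+b''+1}{a'}\binom{a''+b'+1}{a''}.$$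
   Context: $P_n$ is the convex hull of $e_j-e_i$ ($i\ne j$) in $\mathbb{R}^{n+1}$. An arrow $(i,j)$, $i\ne j\in\{1,\dots,n+1\}$, has tail $i$ and head $j$; forward if $i<j$, backward if $i>j$; $V_n$ is the set of arrows ($V_0=\emptyset$). For two arrows with four distinct endpoints $p_1<\dots<p_4$, the type is the $T/H$ word recording tails/heads at $p_1,\dots,p_4$; the tails and heads can be matched in two ways: for types $THTH,HTHT$ one of them nests (joins $\{p_1,p_4\},\{p_2,p_3\}$), for $THHT,HTTH$ one crosses (joins $\{p_1,p_3\},\{p_2,p_4\}$), for $TTHH,HHTT$ one nests and one crosses. A rule set $R$ chooses for each of the six types which matching is an edge. $\Delta_n(R)$ is the flag complex on $V_n$ whose edges are the pairs of distinct arrows with a common tail, those with a common head, and pairs with four distinct endpoints equal to the matching chosen by $R$ for their type; $\Delta_0=\{\emptyset\}$. For $n\ge1$, $\sigma\subseteq V_n$ is saturated if the endpoints of its arrows are exactly $\{1,\dots,n+1\}$; the empty subset of $V_0$ is saturated. $F(\widehat{\mathcal F},x,y,z)=\sum_{n\ge0}\sum_\sigma x^{\#\text{forward arrows of }\sigma}y^{\#\text{backward arrows of }\sigma}z^n$, over saturated faces $\sigma$ of $\Delta_n$. The Delannoy polynomial $D_{a,b}(x)$ is the sum over all lattice paths from $(0,0)$ to $(a,b)$ with steps $(0,1),(1,0),(1,1)$ of $x^{\#\text{steps}}$. -}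

module Defs where

open import Data.Nat using (ℕ; zero; suc; _+_; _*_; _∸_; _≡ᵇ_; _<ᵇ_)
open import Data.Nat.Combinatorics using (_C_)
open import Data.Bool using (Bool; true; false; _∧_; _∨_; not; if_then_else_)
open import Data.Fin using (Fin; toℕ)
open import Data.List using (List; []; _∷_; _++_; map; length; allFin; cartesianProduct; concatMap)
open import Data.Bool.ListAction using (all; any)
open import Data.Product using (_×_; _,_; proj₁; proj₂)

boolFilter : {A : Set} → (A → Bool) → List A → List A
boolFilter p [] = []
boolFilter p (x ∷ xs) = if p x then x ∷ boolFilter p xs else boolFilter p xs

-- Arrows of V_n : ordered pairs (i , j), i ≠ j, of elements of
-- {1,…,n+1}, represented by Fin (suc n) (vertex k+1 is represented by k).

Arrow : ℕ → Set
Arrow n = Fin (suc n) × Fin (suc n)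

tail head : ∀ {n} → Arrow n → ℕ
tail a = toℕ (proj₁ a)
head a = toℕ (proj₂ a)

arrows : (n : ℕ) → List (Arrow n)
arrows n = boolFilter (λ a → not (tail a ≡ᵇ head a))
                      (cartesianProduct (allFin (suc n)) (allFin (suc n)))

forward? backward? : ∀ {n} → Arrow n → Bool
forward? a = tail a <ᵇ head a
backward? a = head a <ᵇ tail a

-- Types of pairs of arrows with four distinct endpoints p₁<p₂<p₃<p₄

data PairType : Set where
  THTH HTHT THHT HTTH TTHH HHTT : PairType

-- the three ways to pair up {p₁,p₂,p₃,p₄} into two pairs:
--   nest : {p₁,p₄},{p₂,p₃};  cross : {p₁,p₃},{p₂,p₄};
--   separate : {p₁,p₂},{p₃,p₄}
data Matching : Set where
  nest cross separate : Matching

_==M_ : Matching → Matching → Bool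
nest ==M nest = true
cross ==M cross = true
separate ==M separate = true
_ ==M _ = false

-- the two tail/head matchings available for each type
data Allowed : PairType → Matching → Set where
  thth-nest : Allowed THTH nest
  thth-sep  : Allowed THTH separate
  htht-nest : Allowed HTHT nest
  htht-sep  : Allowed HTHT separate
  thht-cross : Allowed THHT cross
  thht-sep   : Allowed THHT separate
  htth-cross : Allowed HTTH cross
  htth-sep   : Allowed HTTH separate
  tthh-nest  : Allowed TTHH nest
  tthh-cross : Allowed TTHH cross
  hhtt-nest  : Allowed HHTT nest
  hhtt-cross : Allowed HHTT cross

RuleSet : Set
RuleSet = PairType → Matching

ValidRuleSet : RuleSet → Set
ValidRuleSet R = ∀ t → Allowed t (R t)

-- rank of p among the four endpoints (number of endpoints smaller than p);
-- for four distinct endpoints, p has rank r iff p = p_{r+1}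
rank : ℕ → ℕ → ℕ → ℕ → ℕ → ℕ
rank p e₁ e₂ e₃ e₄ = length (boolFilter (λ e → e <ᵇ p) (e₁ ∷ e₂ ∷ e₃ ∷ e₄ ∷ []))

fourDistinct : ∀ {n} → Arrow n → Arrow n → Bool
fourDistinct u v =
  not (tail u ≡ᵇ tail v) ∧ not (tail u ≡ᵇ head v) ∧
  not (head u ≡ᵇ tail v) ∧ not (head u ≡ᵇ head v)

module _ {n : ℕ} (u v : Arrow n) where
  private
    rk : ℕ → ℕ
    rk p = rank p (tail u) (head u) (tail v) (head v)
    rtu = rk (tail u)
    rhu = rk (head u)
    rtv = rk (tail v)
    rhv = rk (head v)
    tailsAt : ℕ → ℕ → Bool
    tailsAt r s = ((rtu ≡ᵇ r) ∧ (rtv ≡ᵇ s)) ∨ ((rtu ≡ᵇ s) ∧ (rtv ≡ᵇ r))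
    partnerOfFirst : ℕ
    partnerOfFirst =
      if (rtu ≡ᵇ 0) then rhu else
      if (rhu ≡ᵇ 0) then rtu else
      if (rtv ≡ᵇ 0) then rhv else rtv

  -- type of the pair (meaningful when fourDistinct u v)
  pairType : PairType
  pairType =
    if tailsAt 0 2 then THTH else
    if tailsAt 1 3 then HTHT else
    if tailsAt 0 3 then THHT else
    if tailsAt 1 2 then HTTH else
    if tailsAt 0 1 then TTHH else HHTT

  -- the matching formed by the pair {tail u, head u}, {tail v, head v}
  -- (meaningful when fourDistinct u v)
  pairMatching : Matching
  pairMatching =
    if partnerOfFirst ≡ᵇ 1 then separate else
    if partnerOfFirst ≡ᵇ 2 then cross else nest

sameArrow : ∀ {n} → Arrow n → Arrow n → Bool
sameArrow u v = (tail u ≡ᵇ tail v) ∧ (head u ≡ᵇ head v)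

edge : RuleSet → ∀ {n} → Arrow n → Arrow n → Bool
edge R u v =
  not (sameArrow u v) ∧
  ((tail u ≡ᵇ tail v) ∨ (head u ≡ᵇ head v) ∨
   (fourDistinct u v ∧ (R (pairType u v) ==M pairMatching u v)))

-- faces of the flag complex Δ_n(R): cliques of the edge graph
isClique : RuleSet → ∀ {n} → List (Arrow n) → Bool
isClique R [] = true
isClique R (a ∷ σ) = all (edge R a) σ ∧ isClique R σ

-- saturated: endpoints of the arrows are exactly {1,…,n+1} (n ≥ 1);
-- for n = 0 the (only) face ∅ is saturated
saturated : (n : ℕ) → List (Arrow n) → Bool
saturated zero σ = true
saturated (suc n) σ =
  all (λ k → any (λ a → (tail a ≡ᵇ toℕ k) ∨ (head a ≡ᵇ toℕ k)) σ) (allFin (suc (suc n)))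

sublists : {A : Set} → List A → List (List A)
sublists [] = [] ∷ []
sublists (x ∷ xs) = sublists xs ++ map (x ∷_) (sublists xs)

countB : {A : Set} → (A → Bool) → List A → ℕ
countB p xs = length (boolFilter p xs)

-- number of saturated faces of Δ_n(R) with f forward and b backward arrows,
-- i.e. the coefficient of x^f y^b z^n in F(𝓕̂,x,y,z)
satFaces : RuleSet → (n f b : ℕ) → ℕ
satFaces R n f b =
  countB (λ σ → isClique R σ ∧ saturated n σ ∧
                (countB forward? σ ≡ᵇ f) ∧ (countB backward? σ ≡ᵇ b))
         (sublists (arrows n))

data Step : Set where
  up right diag : Step

endpoint : List Step → ℕ × ℕ
endpoint [] = (0 , 0)
endpoint (up ∷ s) = let (p , q) = endpoint s in (p , suc q)
endpoint (right ∷ s) = let (p , q) = endpoint s in (suc p , q)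
endpoint (diag ∷ s) = let (p , q) = endpoint s in (suc p , suc q)

stepWords : ℕ → List (List Step)
stepWords zero = [] ∷ []
stepWords (suc k) = concatMap (λ w → (up ∷ w) ∷ (right ∷ w) ∷ (diag ∷ w) ∷ []) (stepWords k)

-- coefficient of x^k in D_{a,b}(x): number of lattice paths (0,0) → (a,b)
-- with k steps
delannoy : ℕ → ℕ → ℕ → ℕ
delannoy a b k =
  countB (λ w → (proj₁ (endpoint w) ≡ᵇ a) ∧ (proj₂ (endpoint w) ≡ᵇ b)) (stepWords k)

-- Polynomials in x, y with ℕ coefficients, as coefficient functions
-- (p f b = coefficient of x^f y^b)

Poly2 : Set
Poly2 = ℕ → ℕ → ℕ

sumTo : ℕ → (ℕ → ℕ) → ℕ
sumTo zero g = g 0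
sumTo (suc n) g = sumTo n g + g (suc n)

ind : Bool → ℕ
ind true = 1
ind false = 0

_⊕_ : Poly2 → Poly2 → Poly2
(p ⊕ q) f b = p f b + q f b

_⊗_ : Poly2 → Poly2 → Poly2
(p ⊗ q) f b = sumTo f (λ i → sumTo b (λ j → p i j * q (f ∸ i) (b ∸ j)))

_·_ : ℕ → Poly2 → Poly2
(c · p) f b = c * p f b

infixl 6 _⊕_
infixl 7 _⊗_ _·_

𝟙 𝟘 X Y : Poly2
𝟙 f b = ind ((f ≡ᵇ 0) ∧ (b ≡ᵇ 0))
𝟘 f b = 0
X f b = ind ((f ≡ᵇ 1) ∧ (b ≡ᵇ 0))
Y f b = ind ((f ≡ᵇ 0) ∧ (b ≡ᵇ 1))

ΣP : ℕ → (ℕ → Poly2) → Poly2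
ΣP n g f b = sumTo n (λ i → g i f b)

Dx Dy : ℕ → ℕ → Poly2
Dx a b f c = ind (c ≡ᵇ 0) * delannoy a b f
Dy a b f c = ind (f ≡ᵇ 0) * delannoy a b c

-- C(a',b',a'',b'',z) = C₁ z + C₀
C₁ C₀ : ℕ → ℕ → ℕ → ℕ → ℕ
C₁ a' b' a'' b'' = ((a' + b'' + 2) C (a' + 1)) * ((a'' + b' + 2) C (b' + 1))
C₀ a' b' a'' b'' = ((a' + b'' + 1) C b'') * ((a'' + b' + 1) C b')
                 + ((a' + b'' + 1) C a') * ((a'' + b' + 1) C a'')

-- coefficient of z^n on the right-hand side of the formula (a polynomial
-- in x, y): all summation indices of a term contributing to z^n are ≤ n
rhsZ : ℕ → Poly2
rhsZ n =
  ind (n ≡ᵇ 0) · 𝟙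
  ⊕ ΣP n (λ a → ΣP n (λ b →
      ind (a + b + 1 ≡ᵇ n) · (X ⊗ Dx a b ⊕ Y ⊗ Dy a b)))
  ⊕ X ⊗ Y ⊗
    ΣP n (λ a' → ΣP n (λ b' → ΣP n (λ a'' → ΣP n (λ b'' →
      (ind (a' + b' + a'' + b'' + 2 + 1 ≡ᵇ n) * C₁ a' b' a'' b''
       + ind (a' + b' + a'' + b'' + 2 ≡ᵇ n) * C₀ a' b' a'' b'')
      · (Dx a' b' ⊗ Dy a'' b'')))))

module Submission where

-- In a face no vertex is both a tail and a head. All tails of forward arrows precede all
-- heads of forward arrows, and dually for backward arrows; a forward arrow t → h and a
-- backward arrow t' → h' are compatible exactly when t ≤ t', h' ≤ h, t ≠ h' and h ≠ t'.
-- So a saturated face is a word of vertex labels together with a staircase walk (a Delannoy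
-- path) for its forward arrows and one for its backward arrows. In the word, the forward
-- tails and backward heads come first, in any order, followed by the forward heads and
-- backward tails, in any order, and at most one vertex belongs to both groups: the three
-- terms of C(a',b',a'',b'',z) count the words with no such vertex, with a common head and
-- with a common tail.

open import Defs
open import Data.Bool using (Bool; true; false; T; if_then_else_; _∧_; _∨_; not; _xor_)
open import Data.Bool.ListAction using (any)
open import Data.Bool.Properties using (T?; T-∧; T-∨; T-≡; ∧-zeroʳ) renaming (_≟_ to _≟ᵇ_)
open import Data.Empty using (⊥; ⊥-elim)
open import Data.Fin as Fin using (Fin; zero; suc; toℕ; opposite)
open import Data.Fin.Properties as Fin
  using (injective⇒≤; toℕ-injective; toℕ<n; opposite-prop; opposite-involutive)
open import Data.List as List
  using (List; []; _∷_; _++_; map; length; filter; cartesianProduct; tabulate; allFin; concatMap)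
import Data.List.Membership.DecPropositional as DecMembership
open import Data.List.Membership.Propositional using (_∈_; _∉_; find; lose)
open import Data.List.Membership.Propositional.Properties
  using (∈-filter⁺; ∈-filter⁻; ∈-map⁺; ∈-map⁻; ∈-++⁺ˡ; ∈-++⁺ʳ; ∈-++⁻; ∈-cartesianProduct⁺;
         ∈-cartesianProduct⁻; ∈-lookup; ∈-allFin; ∈-tabulate⁺)
open import Data.List.Properties using (length-map; length-++; ∷-injective; map-tabulate)
open import Data.List.Relation.Unary.All as All using (All; []; _∷_)
import Data.List.Relation.Unary.All.Properties as All
open import Data.List.Relation.Unary.AllPairs as AllPairs using (AllPairs; []; _∷_)
import Data.List.Relation.Unary.AllPairs.Properties as AllPairs
open import Data.List.Relation.Unary.Any as Any using (here; there; index; Any)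
open import Data.List.Relation.Unary.Any.Properties as Any using (lookup-index)
open import Data.List.Relation.Unary.Unique.Propositional using (Unique)
open import Data.List.Relation.Unary.Unique.Propositional.Properties as Unique using (Unique[x∷xs]⇒x∉xs)
open import Data.Maybe using (Maybe; just; nothing)
open import Data.Nat using (ℕ; zero; suc; _+_; _*_; _≤_; _<_; z≤n; s≤s; _≡ᵇ_; _<ᵇ_; _<?_; _∸_)
open import Data.Nat.Combinatorics using (_C_; nCk+nC[k+1]≡[n+1]C[k+1]; nCn≡1; nCk≡nC[n∸k])
open import Data.Nat.Properties
  using (≤-antisym; ≤-refl; m≤n⇒m≤1+n; m≤n⇒m<n∨m≡n; <-irrefl; +-identityʳ; suc-injective; _≟_;
         <-asym; <-trans; <⇒≤; <⇒≢; ≤∧≢⇒<; <-cmp; <ᵇ⇒<; <⇒<ᵇ; ≡ᵇ⇒≡; ≡⇒≡ᵇ; +-suc; +-comm; m≤n+m;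
         m+n∸n≡m; *-distribˡ-+; *-identityʳ; ≮⇒≥; ∸-monoʳ-<; <⇒≱; ≤-trans; ≤-reflexive; *-zeroʳ;
         n∸n≡0; m∸n≡0⇒m≤n; ≤-pred; ≤-<-trans)
open import Data.Nat.Tactic.RingSolver using (solve-∀)
open import Data.Product using (_×_; _,_; proj₁; proj₂; ∃; ∃₂)
open import Data.Product.Properties using (≡-dec)
open import Data.Sum using (_⊎_; inj₁; inj₂; [_,_]′)
open import Data.Unit using (tt)
open import Data.Vec as Vec using (Vec; toList; lookup)
open import Data.Vec.Properties using (length-toList; lookup∘tabulate; tabulate∘lookup; tabulate-cong)
open import Function using (_∘_; id)
open import Function.Bundles using (Equivalence)
open import Relation.Binary using (tri<; tri≈; tri>)
open import Relation.Binary.PropositionalEquality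
  using (_≡_; _≢_; refl; sym; trans; cong; cong₂; subst; ≢-sym; subst₂)
open import Relation.Nullary using (¬_; yes; no; Dec; does)
open import Relation.Nullary.Decidable using (_×-dec_; _→-dec_; ¬?; toWitness)

-- The hypotheses leave the types `TTHH` and `HHTT` open, so the proof carries two parameters `r`
-- and `s` and treats the four remaining rule sets at once; only the order in which heads are listed
-- depends on them. Why Delannoy paths: in a suitable order of the heads, the arrows of one
-- direction form a weakly increasing chain in the grid of their tails and heads. Every row and
-- every column of this grid is met, since rows and columns are the vertices that occur in these
-- roles. Consecutive cells therefore differ by a horizontal, a vertical or a diagonal unit step.
-- Saturation enters through the word: it gives every vertex a letter. The obstacle on the
-- combinatorial side is that edges are defined by ranks and types of four endpoints. They are
-- turned into inequalities once, by evaluating every pattern of comparisons.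

private variable
  A B : Set
  P Q : A → Set

-- Counting by duplicate-free enumerations

boolFilter≡filter : (p : A → Bool) (xs : List A) → boolFilter p xs ≡ filter (λ x → T? (p x)) xs
boolFilter≡filter p [] = refl
boolFilter≡filter p (x ∷ xs) with p x
... | true = cong (x ∷_) (boolFilter≡filter p xs)
... | false = boolFilter≡filter p xs

∈-boolFilter⁺ : (p : A → Bool) {x : A} {xs : List A} → x ∈ xs → T (p x) → x ∈ boolFilter p xs
∈-boolFilter⁺ p {xs = xs} i t = subst (_ ∈_) (sym (boolFilter≡filter p xs)) (∈-filter⁺ (λ x → T? (p x)) i t)

∈-boolFilter⁻ : (p : A → Bool) {x : A} {xs : List A} → x ∈ boolFilter p xs → x ∈ xs × T (p x)
∈-boolFilter⁻ p {xs = xs} i = ∈-filter⁻ (λ x → T? (p x)) (subst (_ ∈_) (boolFilter≡filter p xs) i)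

boolFilter-AllPairs : {R : A → A → Set} (p : A → Bool) {xs : List A} → AllPairs R xs → AllPairs R (boolFilter p xs)
boolFilter-AllPairs {R = R} p {xs} u =
  subst (AllPairs R) (sym (boolFilter≡filter p xs)) (AllPairs.filter⁺ (λ x → T? (p x)) u)

-- Predicates on infinite types, such as lists of steps, are counted too; a cardinality is therefore
-- witnessed by an explicit list of all solutions.
record Counts {A : Set} (P : A → Set) (n : ℕ) : Set where
  constructor counts
  field
    list : List A
    unique : Unique list
    sound : ∀ {x} → x ∈ list → P x
    complete : ∀ {x} → P x → x ∈ list
    length≡ : length list ≡ n

lookup-injective : {xs : List A} → Unique xs → ∀ i j → List.lookup xs i ≡ List.lookup xs j → i ≡ j
lookup-injective (_ ∷ _) zero zero _ = refl
lookup-injective {xs = _ ∷ xs} (x∉ ∷ _) zero (suc j) e = ⊥-elim (All.lookup x∉ (∈-lookup {xs = xs} j) e)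
lookup-injective {xs = _ ∷ xs} (x∉ ∷ _) (suc i) zero e = ⊥-elim (All.lookup x∉ (∈-lookup {xs = xs} i) (sym e))
lookup-injective (_ ∷ u) (suc i) (suc j) e = cong suc (lookup-injective u i j e)

inject-≤ : {xs : List A} {ys : List B} (R : A → B → Set) → Unique xs →
  (∀ {x} → x ∈ xs → ∃ λ y → y ∈ ys × R x y) →
  (∀ {x x' y} → x ∈ xs → x' ∈ xs → R x y → R x' y → x ≡ x') → length xs ≤ length ys
inject-≤ {A = A} {xs = xs} {ys} R u f inj = injective⇒≤ {f = g} g-inj
  where
  partner : ∀ i → ∃ λ y → y ∈ ys × R (List.lookup xs i) y
  partner i = f (∈-lookup i)
  g : Fin (length xs) → Fin (length ys)
  g i = index (proj₁ (proj₂ (partner i)))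
  same : ∀ i j → g i ≡ g j → proj₁ (partner i) ≡ proj₁ (partner j)
  same i j e = trans (lookup-index (proj₁ (proj₂ (partner i))))
    (trans (cong (List.lookup ys) e) (sym (lookup-index (proj₁ (proj₂ (partner j))))))
  g-inj : ∀ {i j} → g i ≡ g j → i ≡ j
  g-inj {i} {j} e = lookup-injective u i j
    (inj (∈-lookup i) (∈-lookup j) (subst (R _) (same i j e) (proj₂ (proj₂ (partner i)))) (proj₂ (proj₂ (partner j))))

-- Each totality hypothesis supplies partners and each cancellation hypothesis makes their choice
-- injective, so the pigeonhole bound applies in both directions. A relation fits better than a
-- function here: a walk lists the arrows of a face in another order than `arrows n` does.
counts-correspond : ∀ {m n} (R : A → B → Set) → Counts P m → Counts Q n →
  (∀ {x} → P x → ∃ λ y → Q y × R x y) → (∀ {y} → Q y → ∃ λ x → P x × R x y) →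
  (∀ {x x' y} → P x → P x' → R x y → R x' y → x ≡ x') →
  (∀ {x y y'} → Q y → Q y' → R x y → R x y' → y ≡ y') → m ≡ n
counts-correspond R (counts xs ux sx cx refl) (counts ys uy sy cy refl) f g inj fun =
  ≤-antisym
    (inject-≤ R ux (λ i → let y , q , r = f (sx i) in y , cy q , r) (λ i j → inj (sx i) (sx j)))
    (inject-≤ (λ y x → R x y) uy (λ i → let x , p , r = g (sy i) in x , cx p , r) (λ i j → fun (sy i) (sy j)))

unique-length : {xs ys : List A} → Unique xs → Unique ys → (∀ {x} → x ∈ xs → x ∈ ys) → (∀ {x} → x ∈ ys → x ∈ xs) →
  length xs ≡ length ys
unique-length ux uy f g = counts-correspond _≡_ (counts _ ux f g refl) (counts _ uy (λ i → i) (λ i → i) refl)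
  (λ p → _ , p , refl) (λ q → _ , q , refl) (λ { _ _ refl refl → refl }) (λ { _ _ refl refl → refl })

counts-⇔ : ∀ {n} → (∀ {x} → P x → Q x) → (∀ {x} → Q x → P x) → Counts P n → Counts Q n
counts-⇔ f g (counts xs u s c l) = counts xs u (λ i → f (s i)) (λ q → c (g q)) l

counts-∅ : (∀ {x} → ¬ P x) → Counts P 0
counts-∅ e = counts [] [] (λ ()) (λ p → ⊥-elim (e p)) refl

counts-singleton : (x : A) → P x → (∀ {y} → P y → y ≡ x) → Counts P 1
counts-singleton x p h = counts (x ∷ []) ([] ∷ []) (λ { (here refl) → p }) (λ q → here (h q)) refl

counts-⊎ : ∀ {m n} → Counts P m → Counts Q n → (∀ {x} → P x → ¬ Q x) → Counts (λ x → P x ⊎ Q x) (m + n)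
counts-⊎ (counts xs ux sx cx refl) (counts ys uy sy cy refl) dis = counts (xs ++ ys)
  (Unique.++⁺ ux uy (λ (i , j) → dis (sx i) (sy j)))
  (λ i → [ (λ j → inj₁ (sx j)) , (λ j → inj₂ (sy j)) ]′ (∈-++⁻ xs i))
  (λ { (inj₁ p) → ∈-++⁺ˡ (cx p) ; (inj₂ q) → ∈-++⁺ʳ xs (cy q) })
  (length-++ xs)

length-cartesianProduct : (xs : List A) (ys : List B) → length (cartesianProduct xs ys) ≡ length xs * length ys
length-cartesianProduct [] ys = refl
length-cartesianProduct (x ∷ xs) ys = trans (length-++ (map (x ,_) ys))
  (cong₂ _+_ (length-map (x ,_) ys) (length-cartesianProduct xs ys))

counts-× : ∀ {m n} → Counts P m → Counts Q n → Counts (λ (x , y) → P x × Q y) (m * n)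
counts-× (counts xs ux sx cx refl) (counts ys uy sy cy refl) = counts (cartesianProduct xs ys)
  (Unique.cartesianProduct⁺ ux uy)
  (λ i → let j , k = ∈-cartesianProduct⁻ xs ys i in sx j , sy k)
  (λ (p , q) → ∈-cartesianProduct⁺ (cx p) (cy q))
  (length-cartesianProduct xs ys)

unique-map : {f : A → B} {xs : List A} → (∀ {x y} → x ∈ xs → y ∈ xs → f x ≡ f y → x ≡ y) → Unique xs → Unique (map f xs)
unique-map inj [] = []
unique-map {f = f} inj (x∉ ∷ u) =
  All.map⁺ (All.tabulate λ i e → All.lookup x∉ i (inj (here refl) (there i) e))
  ∷ unique-map (λ i j → inj (there i) (there j)) u

counts-image : ∀ {n} (f : A → B) → (∀ {x y} → P x → P y → f x ≡ f y → x ≡ y) →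
  (∀ {x} → P x → Q (f x)) → (∀ {y} → Q y → ∃ λ x → P x × f x ≡ y) → Counts P n → Counts Q n
counts-image {Q = Q} f inj to from (counts xs u s c l) = counts (map f xs)
  (unique-map (λ i j → inj (s i) (s j)) u)
  (λ i → let x , j , e = ∈-map⁻ f i in subst Q (sym e) (to (s j)))
  (λ q → let x , p , e = from q in subst (_∈ map f xs) e (∈-map⁺ f (c p)))
  (trans (length-map f xs) l)

-- Source of the indicators `ind (… ≡ᵇ n)` in the formula: the solutions themselves force `b`, so
-- there are none when `b` is false.
counts-ind : ∀ {n} b → (T b → Counts P n) → (∀ {x} → P x → T b) → Counts P (ind b * n)
counts-ind {P = P} {n = n} true c _ = subst (Counts P) (sym (+-identityʳ n)) (c _)
counts-ind false _ e = counts-∅ e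

counts-sum : (P : ℕ → A → Set) (g : ℕ → ℕ) (n : ℕ) → (∀ i → i ≤ n → Counts (P i) (g i)) →
  (∀ {i j x} → P i x → P j x → i ≡ j) → Counts (λ x → ∃ λ i → i ≤ n × P i x) (sumTo n g)
counts-sum P g zero c dis = counts-⇔ (λ p → 0 , z≤n , p) (λ { (zero , _ , p) → p }) (c 0 z≤n)
counts-sum P g (suc n) c dis = counts-⇔
  (λ { (inj₁ (i , le , p)) → i , m≤n⇒m≤1+n le , p ; (inj₂ p) → suc n , ≤-refl , p })
  (λ (i , le , p) → split i p (m≤n⇒m<n∨m≡n le))
  (counts-⊎ (counts-sum P g n (λ i le → c i (m≤n⇒m≤1+n le)) dis) (c (suc n) ≤-refl)
    (λ (i , le , p) q → <-irrefl (dis p q) (s≤s le)))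
  where
  split : ∀ i {x} → P i x → i < suc n ⊎ i ≡ suc n → (∃ λ i → i ≤ n × P i x) ⊎ P (suc n) x
  split i p (inj₁ (s≤s le)) = inj₁ (i , le , p)
  split i p (inj₂ refl) = inj₂ p

counts-boolFilter : (p : A → Bool) (xs : List A) → Unique xs → Counts (λ x → x ∈ xs × T (p x)) (countB p xs)
counts-boolFilter p xs u = counts (boolFilter p xs) (boolFilter-AllPairs p u)
  (∈-boolFilter⁻ p) (λ (i , t) → ∈-boolFilter⁺ p i t) refl

-- Sublists as finite sets

sublists-⊆ : {σ xs : List A} → σ ∈ sublists xs → ∀ {x} → x ∈ σ → x ∈ xs
sublists-⊆ {xs = []} (here refl) ()
sublists-⊆ {xs = x ∷ xs} i j with ∈-++⁻ (sublists xs) i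
... | inj₁ k = there (sublists-⊆ k j)
... | inj₂ k with ∈-map⁻ (x ∷_) k
...   | τ , l , refl with j
...     | here refl = here refl
...     | there j' = there (sublists-⊆ l j')

sublists-AllPairs : {R : A → A → Set} {σ xs : List A} → AllPairs R xs → σ ∈ sublists xs → AllPairs R σ
sublists-AllPairs {xs = []} _ (here refl) = []
sublists-AllPairs {xs = x ∷ xs} (r ∷ u) i with ∈-++⁻ (sublists xs) i
... | inj₁ k = sublists-AllPairs u k
... | inj₂ k with ∈-map⁻ (x ∷_) k
...   | τ , l , refl = All.tabulate (λ j → All.lookup r (sublists-⊆ l j)) ∷ sublists-AllPairs u l

-- A sublist inherits the order of `xs`, so a set of arrows has a single representative and faces
-- can be compared by membership alone.
sublists-ext : {σ τ xs : List A} → Unique xs → σ ∈ sublists xs → τ ∈ sublists xs →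
  (∀ {x} → x ∈ σ → x ∈ τ) → (∀ {x} → x ∈ τ → x ∈ σ) → σ ≡ τ
sublists-ext {xs = []} _ (here refl) (here refl) _ _ = refl
sublists-ext {xs = x ∷ xs} u@(_ ∷ u') i j f g with ∈-++⁻ (sublists xs) i | ∈-++⁻ (sublists xs) j
... | inj₁ k | inj₁ l = sublists-ext u' k l f g
... | inj₁ k | inj₂ l with ∈-map⁻ (x ∷_) l
...   | _ , _ , refl = ⊥-elim (Unique[x∷xs]⇒x∉xs u (sublists-⊆ k (g (here refl))))
sublists-ext {xs = x ∷ xs} u@(_ ∷ u') i j f g | inj₂ k | inj₁ l with ∈-map⁻ (x ∷_) k
...   | _ , _ , refl = ⊥-elim (Unique[x∷xs]⇒x∉xs u (sublists-⊆ l (f (here refl))))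
sublists-ext {xs = x ∷ xs} u@(_ ∷ u') i j f g | inj₂ k | inj₂ l with ∈-map⁻ (x ∷_) k | ∈-map⁻ (x ∷_) l
...   | σ' , k' , refl | τ' , l' , refl = cong (x ∷_) (sublists-ext u' k' l'
          (λ a → strip (sublists-⊆ k' a) (f (there a))) (λ a → strip (sublists-⊆ l' a) (g (there a))))
  where
  strip : ∀ {y ρ} → y ∈ xs → y ∈ x ∷ ρ → y ∈ ρ
  strip y∈ (here refl) = ⊥-elim (Unique[x∷xs]⇒x∉xs u y∈)
  strip y∈ (there a) = a

sublists-unique : {xs : List A} → Unique xs → Unique (sublists xs)
sublists-unique [] = [] ∷ []
sublists-unique {xs = x ∷ xs} u@(_ ∷ u') = Unique.++⁺ (sublists-unique u')
  (Unique.map⁺ (λ { refl → refl }) (sublists-unique u'))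
  (λ (i , j) → dis i (∈-map⁻ (x ∷_) j))
  where
  dis : ∀ {σ} → σ ∈ sublists xs → (∃ λ τ → τ ∈ sublists xs × σ ≡ x ∷ τ) → ⊥
  dis i (_ , _ , refl) = Unique[x∷xs]⇒x∉xs u (sublists-⊆ i (here refl))

boolFilter∈sublists : (p : A → Bool) (xs : List A) → boolFilter p xs ∈ sublists xs
boolFilter∈sublists p [] = here refl
boolFilter∈sublists p (x ∷ xs) with p x
... | true = ∈-++⁺ʳ (sublists xs) (∈-map⁺ (x ∷_) (boolFilter∈sublists p xs))
... | false = ∈-++⁺ˡ (boolFilter∈sublists p xs)

-- Staircase walks

-- The offset: `p` tails and `q` heads are traversed by `p - 1` moves right and `q - 1` moves up, a
-- diagonal step being one of each. Hence $D_{a,b}$ belongs to `a + 1` tails and `b + 1` heads.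
EndsAt : ℕ → ℕ → List Step → Set
EndsAt p q w = p ≡ suc (proj₁ (endpoint w)) × q ≡ suc (proj₂ (endpoint w))

module _ {A B : Set} where

  walk : List A → List B → List Step → List (A × B)
  walk (t ∷ ts) (h ∷ hs) [] = (t , h) ∷ []
  walk (t ∷ ts) (h ∷ hs) (up ∷ w) = (t , h) ∷ walk (t ∷ ts) hs w
  walk (t ∷ ts) (h ∷ hs) (right ∷ w) = (t , h) ∷ walk ts (h ∷ hs) w
  walk (t ∷ ts) (h ∷ hs) (diag ∷ w) = (t , h) ∷ walk ts hs w
  walk _ _ _ = []

  data Fits : List A → List B → List Step → Set where
    stop : ∀ {t h} → Fits (t ∷ []) (h ∷ []) []
    up : ∀ {t ts h hs w} → Fits (t ∷ ts) hs w → Fits (t ∷ ts) (h ∷ hs) (up ∷ w)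
    right : ∀ {t ts h hs w} → Fits ts (h ∷ hs) w → Fits (t ∷ ts) (h ∷ hs) (right ∷ w)
    diag : ∀ {t ts h hs w} → Fits ts hs w → Fits (t ∷ ts) (h ∷ hs) (diag ∷ w)

  Fits⇒EndsAt : ∀ {ts hs w} → Fits ts hs w → EndsAt (length ts) (length hs) w
  Fits⇒EndsAt stop = refl , refl
  Fits⇒EndsAt (up d) = let e , e' = Fits⇒EndsAt d in e , cong suc e'
  Fits⇒EndsAt (right d) = let e , e' = Fits⇒EndsAt d in cong suc e , e'
  Fits⇒EndsAt (diag d) = let e , e' = Fits⇒EndsAt d in cong suc e , cong suc e'

  EndsAt⇒Fits : ∀ ts hs w → EndsAt (length ts) (length hs) w → Fits ts hs w
  EndsAt⇒Fits (t ∷ []) (h ∷ []) [] (refl , refl) = stop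
  EndsAt⇒Fits (t ∷ ts) (h ∷ hs) (up ∷ w) (e , e') = up (EndsAt⇒Fits (t ∷ ts) hs w (e , suc-injective e'))
  EndsAt⇒Fits (t ∷ ts) (h ∷ hs) (right ∷ w) (e , e') = right (EndsAt⇒Fits ts (h ∷ hs) w (suc-injective e , e'))
  EndsAt⇒Fits (t ∷ ts) (h ∷ hs) (diag ∷ w) (e , e') = diag (EndsAt⇒Fits ts hs w (suc-injective e , suc-injective e'))

  -- The starting cell is counted as well; this extra arrow is the factor $x$ or $y$ in front of
  -- each Delannoy polynomial.
  length-walk : ∀ {ts hs w} → Fits ts hs w → length (walk ts hs w) ≡ suc (length w)
  length-walk stop = refl
  length-walk (up d) = cong suc (length-walk d)
  length-walk (right d) = cong suc (length-walk d)
  length-walk (diag d) = cong suc (length-walk d)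

  walk-⊆ : ∀ {ts hs w x y} → Fits ts hs w → (x , y) ∈ walk ts hs w → x ∈ ts × y ∈ hs
  walk-⊆ stop (here refl) = here refl , here refl
  walk-⊆ (up d) (here refl) = here refl , here refl
  walk-⊆ (up d) (there i) = let j , k = walk-⊆ d i in j , there k
  walk-⊆ (right d) (here refl) = here refl , here refl
  walk-⊆ (right d) (there i) = let j , k = walk-⊆ d i in there j , k
  walk-⊆ (diag d) (here refl) = here refl , here refl
  walk-⊆ (diag d) (there i) = let j , k = walk-⊆ d i in there j , there k

  walk-row : ∀ {ts hs w x} → Fits ts hs w → x ∈ ts → ∃ λ y → (x , y) ∈ walk ts hs w
  walk-row stop (here refl) = _ , here refl
  walk-row (up d) i = let y , j = walk-row d i in y , there j
  walk-row (right d) (here refl) = _ , here refl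
  walk-row (right d) (there i) = let y , j = walk-row d i in y , there j
  walk-row (diag d) (here refl) = _ , here refl
  walk-row (diag d) (there i) = let y , j = walk-row d i in y , there j

  walk-column : ∀ {ts hs w y} → Fits ts hs w → y ∈ hs → ∃ λ x → (x , y) ∈ walk ts hs w
  walk-column stop (here refl) = _ , here refl
  walk-column (up d) (here refl) = _ , here refl
  walk-column (up d) (there i) = let y , j = walk-column d i in y , there j
  walk-column (right d) i = let y , j = walk-column d i in y , there j
  walk-column (diag d) (here refl) = _ , here refl
  walk-column (diag d) (there i) = let y , j = walk-column d i in y , there j

  -- Weak monotonicity in negative form: no two cells are oppositely ordered. This is literally the
  -- shape of the second half of the same-direction conditions in `Agree`.
  Chain : (A → A → Set) → (B → B → Set) → (A → B → Set) → Set
  Chain _<₁_ _<₂_ S = ∀ {x y x' y'} → S x y → S x' y' → ¬ (x <₁ x' × y' <₂ y)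

  module _ {_<₁_ : A → A → Set} {_<₂_ : B → B → Set}
           (asym₁ : ∀ {x y} → x <₁ y → ¬ (y <₁ x)) (asym₂ : ∀ {x y} → x <₂ y → ¬ (y <₂ x)) where

    private
      fresh : {C : Set} {_≺_ : C → C → Set} → (∀ {x y} → x ≺ y → ¬ (y ≺ x)) → ∀ {x xs} → All (x ≺_) xs → x ∉ xs
      fresh asym a i = let r = All.lookup a i in asym r r

      first-min : {C : Set} {_≺_ : C → C → Set} → (∀ {x y} → x ≺ y → ¬ (y ≺ x)) →
        ∀ {x y xs} → All (x ≺_) xs → y ∈ x ∷ xs → ¬ (y ≺ x)
      first-min asym a (here refl) r = asym r r
      first-min asym a (there i) r = asym r (All.lookup a i)

    -- The first cell is minimal in both coordinates, so it belongs to no oppositely ordered pair;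
    -- any other pair lies in the rest of the walk.
    walk-chain : ∀ {ts hs w} → AllPairs _<₁_ ts → AllPairs _<₂_ hs → Fits ts hs w →
      Chain _<₁_ _<₂_ (λ x y → (x , y) ∈ walk ts hs w)
    walk-chain {ts} {hs} a₁ a₂ d i j (r₁ , r₂) = go a₁ a₂ d i j r₁ r₂
      where
      corner : ∀ {t ts h hs x y x' y'} → All (t <₁_) ts → All (h <₂_) hs →
        x' ∈ t ∷ ts → y' ∈ h ∷ hs → x ≡ t → y ≡ h → x <₁ x' → y' <₂ y → ⊥
      corner a₁ a₂ i' j' refl refl r₁ r₂ = first-min asym₂ a₂ j' r₂
      corner' : ∀ {t ts h hs x y x' y'} → All (t <₁_) ts → All (h <₂_) hs →
        x ∈ t ∷ ts → y ∈ h ∷ hs → x' ≡ t → y' ≡ h → x <₁ x' → y' <₂ y → ⊥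
      corner' a₁ a₂ i' j' refl refl r₁ r₂ = first-min asym₁ a₁ i' r₁
      go : ∀ {ts hs w x y x' y'} → AllPairs _<₁_ ts → AllPairs _<₂_ hs → Fits ts hs w →
        (x , y) ∈ walk ts hs w → (x' , y') ∈ walk ts hs w → x <₁ x' → y' <₂ y → ⊥
      go _ _ stop (here refl) (here refl) r₁ r₂ = asym₁ r₁ r₁
      go (a ∷ _) (b ∷ _) d@(up _) (here refl) j r₁ r₂ = let p , q = walk-⊆ d j in corner a b p q refl refl r₁ r₂
      go (a ∷ _) (b ∷ _) d@(right _) (here refl) j r₁ r₂ = let p , q = walk-⊆ d j in corner a b p q refl refl r₁ r₂
      go (a ∷ _) (b ∷ _) d@(diag _) (here refl) j r₁ r₂ = let p , q = walk-⊆ d j in corner a b p q refl refl r₁ r₂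
      go (a ∷ _) (b ∷ _) d@(up _) i@(there _) (here refl) r₁ r₂ = let p , q = walk-⊆ d i in corner' a b p q refl refl r₁ r₂
      go (a ∷ _) (b ∷ _) d@(right _) i@(there _) (here refl) r₁ r₂ = let p , q = walk-⊆ d i in corner' a b p q refl refl r₁ r₂
      go (a ∷ _) (b ∷ _) d@(diag _) i@(there _) (here refl) r₁ r₂ = let p , q = walk-⊆ d i in corner' a b p q refl refl r₁ r₂
      go a (_ ∷ b) (up d) (there i) (there j) = go a b d i j
      go (_ ∷ a) b (right d) (there i) (there j) = go a b d i j
      go (_ ∷ a) (_ ∷ b) (diag d) (there i) (there j) = go a b d i j

    walk-unique : ∀ {ts hs w} → AllPairs _<₁_ ts → AllPairs _<₂_ hs → Fits ts hs w → Unique (walk ts hs w)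
    walk-unique a b stop = [] ∷ []
    walk-unique a (x ∷ b) (up d) = All.tabulate (λ { i refl → fresh asym₂ x (proj₂ (walk-⊆ d i)) }) ∷ walk-unique a b d
    walk-unique (x ∷ a) b (right d) = All.tabulate (λ { i refl → fresh asym₁ x (proj₁ (walk-⊆ d i)) }) ∷ walk-unique a b d
    walk-unique (x ∷ a) (_ ∷ b) (diag d) = All.tabulate (λ { i refl → fresh asym₁ x (proj₁ (walk-⊆ d i)) }) ∷ walk-unique a b d

    private
      drop-first : {C : Set} {c c' : C} {cs : List C} → c ≢ c' → c ∈ c' ∷ cs → c ∈ cs
      drop-first ne (here e) = ⊥-elim (ne e)
      drop-first ne (there i) = i

      up-row : ∀ {t ts hs w} → Fits (t ∷ ts) hs w → ∃ λ y → y ∈ hs × (t , y) ∈ walk (t ∷ ts) hs w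
      up-row d = let y , i = walk-row d (here refl) in y , proj₂ (walk-⊆ d i) , i

      right-column : ∀ {ts h hs w} → Fits ts (h ∷ hs) w → ∃ λ x → x ∈ ts × (x , h) ∈ walk ts (h ∷ hs) w
      right-column d = let x , i = walk-column d (here refl) in x , proj₁ (walk-⊆ d i) , i

      off-row : ∀ {t ts h hs hs' w y} → All (t <₁_) ts → All (h <₂_) hs → Fits ts hs' w →
        y ∈ hs → (t , y) ∈ (t , h) ∷ walk ts hs' w → ⊥
      off-row a b d j (here refl) = fresh asym₂ b j
      off-row a b d j (there i) = fresh asym₁ a (proj₁ (walk-⊆ d i))

      off-column : ∀ {t ts ts' h hs w x} → All (t <₁_) ts → All (h <₂_) hs → Fits ts' hs w →
        x ∈ ts → (x , h) ∈ (t , h) ∷ walk ts' hs w → ⊥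
      off-column a b d j (here refl) = fresh asym₁ a j
      off-column a b d j (there i) = fresh asym₂ b (proj₂ (walk-⊆ d i))

    -- The first step can be read off the set of cells: it is `up` when the row of the first tail
    -- has a second cell, `right` when the column of the first head has one, and `diag` when neither
    -- does.
    walk-injective : ∀ {ts hs w w'} → AllPairs _<₁_ ts → AllPairs _<₂_ hs → Fits ts hs w → Fits ts hs w' →
      (∀ {a} → a ∈ walk ts hs w → a ∈ walk ts hs w') → (∀ {a} → a ∈ walk ts hs w' → a ∈ walk ts hs w) → w ≡ w'
    walk-injective a b stop stop f g = refl
    walk-injective a (x ∷ b) (up d) (up d') f g = cong (up ∷_) (walk-injective a b d d'
      (λ i → drop-first (λ { refl → fresh asym₂ x (proj₂ (walk-⊆ d i)) }) (f (there i)))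
      (λ i → drop-first (λ { refl → fresh asym₂ x (proj₂ (walk-⊆ d' i)) }) (g (there i))))
    walk-injective (x ∷ a) b (right d) (right d') f g = cong (right ∷_) (walk-injective a b d d'
      (λ i → drop-first (λ { refl → fresh asym₁ x (proj₁ (walk-⊆ d i)) }) (f (there i)))
      (λ i → drop-first (λ { refl → fresh asym₁ x (proj₁ (walk-⊆ d' i)) }) (g (there i))))
    walk-injective (x ∷ a) (_ ∷ b) (diag d) (diag d') f g = cong (diag ∷_) (walk-injective a b d d'
      (λ i → drop-first (λ { refl → fresh asym₁ x (proj₁ (walk-⊆ d i)) }) (f (there i)))
      (λ i → drop-first (λ { refl → fresh asym₁ x (proj₁ (walk-⊆ d' i)) }) (g (there i))))
    walk-injective (x ∷ a) (z ∷ b) (up d) (right d') f g =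
      let _ , j , i = up-row d in ⊥-elim (off-row x z d' j (f (there i)))
    walk-injective (x ∷ a) (z ∷ b) (up d) (diag d') f g =
      let _ , j , i = up-row d in ⊥-elim (off-row x z d' j (f (there i)))
    walk-injective (x ∷ a) (z ∷ b) (right d) (up d') f g =
      let _ , j , i = up-row d' in ⊥-elim (off-row x z d j (g (there i)))
    walk-injective (x ∷ a) (z ∷ b) (diag d) (up d') f g =
      let _ , j , i = up-row d' in ⊥-elim (off-row x z d j (g (there i)))
    walk-injective (x ∷ a) (z ∷ b) (right d) (diag d') f g =
      let _ , j , i = right-column d in ⊥-elim (off-column x z d' j (f (there i)))
    walk-injective (x ∷ a) (z ∷ b) (diag d) (right d') f g =
      let _ , j , i = right-column d' in ⊥-elim (off-column x z d j (g (there i)))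

    record Traces (S : A → B → Set) (ts : List A) (hs : List B) : Set where
      constructor traces
      field
        steps : List Step
        fits : Fits ts hs steps
        sound : ∀ {x y} → (x , y) ∈ walk ts hs steps → S x y
        complete : ∀ {x y} → x ∈ ts → y ∈ hs → S x y → (x , y) ∈ walk ts hs steps

    private
      cons-sound : ∀ {S : A → B → Set} {t h l} → S t h → (∀ {x y} → (x , y) ∈ l → S x y) →
        ∀ {x y} → (x , y) ∈ (t , h) ∷ l → S x y
      cons-sound s f (here refl) = s
      cons-sound s f (there i) = f i

    -- The smallest corner lies on every covering chain; the row and the column
    -- through it cannot both meet the chain again, which leaves one of the three steps.
    chain-traces : (S : A → B → Set) → (∀ x y → Dec (S x y)) → Chain _<₁_ _<₂_ S →
      ∀ t ts h hs → AllPairs _<₁_ (t ∷ ts) → AllPairs _<₂_ (h ∷ hs) →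
      (∀ {x} → x ∈ t ∷ ts → ∃ λ y → y ∈ h ∷ hs × S x y) →
      (∀ {y} → y ∈ h ∷ hs → ∃ λ x → x ∈ t ∷ ts × S x y) → Traces S (t ∷ ts) (h ∷ hs)
    chain-traces S S? chain = go
      where
      corner : ∀ {t ts h hs} → AllPairs _<₁_ (t ∷ ts) → AllPairs _<₂_ (h ∷ hs) →
        (∃ λ y → y ∈ h ∷ hs × S t y) → (∃ λ x → x ∈ t ∷ ts × S x h) → S t h
      corner _ _ (_ , here refl , s) _ = s
      corner _ _ (_ , there _ , _) (_ , here refl , s) = s
      -- The cell of `t` with a later head and the cell of `h` with a later tail are oppositely
      -- ordered.
      corner (a ∷ _) (b ∷ _) (_ , there j , s) (_ , there i , s') =
        ⊥-elim (chain s s' (All.lookup a i , All.lookup b j))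

      go : ∀ t ts h hs → AllPairs _<₁_ (t ∷ ts) → AllPairs _<₂_ (h ∷ hs) →
        (∀ {x} → x ∈ t ∷ ts → ∃ λ y → y ∈ h ∷ hs × S x y) →
        (∀ {y} → y ∈ h ∷ hs → ∃ λ x → x ∈ t ∷ ts × S x y) → Traces S (t ∷ ts) (h ∷ hs)
      go t ts h hs a b row col with Any.any? (S? t) hs | Any.any? (λ x → S? x h) ts
      go t ts h (h' ∷ hs) a@(at ∷ _) b@(bh ∷ b') row col | yes r | _
        with find r
      ... | y₀ , j₀ , s₀ with go t ts h' hs a b' row' (λ j → col (there j))
        where
        row' : ∀ {x} → x ∈ t ∷ ts → ∃ λ y → y ∈ h' ∷ hs × S x y
        row' (here refl) = y₀ , j₀ , s₀
        row' (there i) with row (there i)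
        -- Row `t` has the cell `(t , y₀)` beyond `h`, so a cell of a later row in column `h` would
        -- break the chain. Thus only `t` meets column `h`, and dropping `h` leaves the other rows
        -- covered.
        ... | _ , here refl , s = ⊥-elim (chain s₀ s (All.lookup at i , All.lookup bh j₀))
        ... | y , there j , s = y , j , s
      ...   | traces w d f g = traces (up ∷ w) (up d)
                (cons-sound (corner a b (row (here refl)) (col (here refl))) f) complete
        where
        complete : ∀ {x y} → x ∈ t ∷ ts → y ∈ h ∷ h' ∷ hs → S x y → (x , y) ∈ (t , h) ∷ walk (t ∷ ts) (h' ∷ hs) w
        complete (here refl) (here refl) s = here refl
        complete (there i) (here refl) s = ⊥-elim (chain s₀ s (All.lookup at i , All.lookup bh j₀))
        complete i (there j) s = there (g i j s)
      go t (t' ∷ ts) h hs a@(at ∷ a') b@(bh ∷ _) row col | no ¬r | yes c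
        with find c
      ... | x₀ , i₀ , s₀ with go t' ts h hs a' b (λ i → row (there i)) col'
        where
        col' : ∀ {y} → y ∈ h ∷ hs → ∃ λ x → x ∈ t' ∷ ts × S x y
        col' (here refl) = x₀ , i₀ , s₀
        col' (there j) with col (there j)
        ... | _ , here refl , s = ⊥-elim (¬r (lose j s))
        ... | x , there i , s = x , i , s
      ...   | traces w d f g = traces (right ∷ w) (right d)
                (cons-sound (corner a b (row (here refl)) (col (here refl))) f) complete
        where
        complete : ∀ {x y} → x ∈ t ∷ t' ∷ ts → y ∈ h ∷ hs → S x y → (x , y) ∈ (t , h) ∷ walk (t' ∷ ts) (h ∷ hs) w
        complete (here refl) (here refl) s = here refl
        complete (here refl) (there j) s = ⊥-elim (¬r (lose j s))
        complete (there i) j s = there (g i j s)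
      go t [] h [] a b row col | no ¬r | no ¬c = traces [] stop
        (λ { (here refl) → corner a b (row (here refl)) (col (here refl)) })
        (λ { (here refl) (here refl) _ → here refl })
      go t [] h (h' ∷ hs) a b row col | no ¬r | no ¬c with col (there (here refl))
      ... | _ , here refl , s = ⊥-elim (¬r (here s))
      go t (t' ∷ ts) h [] a b row col | no ¬r | no ¬c with row (there (here refl))
      ... | _ , here refl , s = ⊥-elim (¬c (here s))
      go t (t' ∷ ts) h (h' ∷ hs) a@(_ ∷ a') b@(_ ∷ b') row col | no ¬r | no ¬c
        with go t' ts h' hs a' b' row' col'
        where
        row' : ∀ {x} → x ∈ t' ∷ ts → ∃ λ y → y ∈ h' ∷ hs × S x y
        row' i with row (there i)
        ... | _ , here refl , s = ⊥-elim (¬c (lose i s))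
        ... | y , there j , s = y , j , s
        col' : ∀ {y} → y ∈ h' ∷ hs → ∃ λ x → x ∈ t' ∷ ts × S x y
        col' j with col (there j)
        ... | _ , here refl , s = ⊥-elim (¬r (lose j s))
        ... | x , there i , s = x , i , s
      ... | traces w d f g = traces (diag ∷ w) (diag d)
              (cons-sound (corner a b (row (here refl)) (col (here refl))) f) complete
        where
        complete : ∀ {x y} → x ∈ t ∷ t' ∷ ts → y ∈ h ∷ h' ∷ hs → S x y → (x , y) ∈ (t , h) ∷ walk (t' ∷ ts) (h' ∷ hs) w
        complete (here refl) (here refl) s = here refl
        complete (here refl) (there j) s = ⊥-elim (¬r (lose j s))
        complete (there i) (here refl) s = ⊥-elim (¬c (lose i s))
        complete (there i) (there j) s = there (g i j s)

  -- `nothing` means that the direction has no arrow at all, whereas `just []` is a single arrow.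
  -- The distinction separates the terms in $x$ alone, in $y$ alone and in $xy$.
  trail : List A → List B → Maybe (List Step) → List (A × B)
  trail ts hs nothing = []
  trail ts hs (just w) = walk ts hs w

  TrailFits : List A → List B → Maybe (List Step) → Set
  TrailFits ts hs nothing = ts ≡ [] × hs ≡ []
  TrailFits ts hs (just w) = Fits ts hs w

trailLength : Maybe (List Step) → ℕ
trailLength nothing = 0
trailLength (just w) = suc (length w)

TrailEndsAt : ℕ → ℕ → Maybe (List Step) → Set
TrailEndsAt p q nothing = p ≡ 0 × q ≡ 0
TrailEndsAt p q (just w) = EndsAt p q w

private
  length≡0 : {A : Set} (xs : List A) → length xs ≡ 0 → xs ≡ []
  length≡0 [] _ = refl

module _ {A B : Set} where

  TrailFits⇒EndsAt : ∀ {ts : List A} {hs : List B} m → TrailFits ts hs m → TrailEndsAt (length ts) (length hs) m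
  TrailFits⇒EndsAt nothing (refl , refl) = refl , refl
  TrailFits⇒EndsAt (just w) d = Fits⇒EndsAt d

  EndsAt⇒TrailFits : ∀ (ts : List A) (hs : List B) m → TrailEndsAt (length ts) (length hs) m → TrailFits ts hs m
  EndsAt⇒TrailFits ts hs nothing (e , e') = length≡0 ts e , length≡0 hs e'
  EndsAt⇒TrailFits ts hs (just w) e = EndsAt⇒Fits ts hs w e

  length-trail : ∀ {ts : List A} {hs : List B} m → TrailFits ts hs m → length (trail ts hs m) ≡ trailLength m
  length-trail nothing _ = refl
  length-trail (just w) d = length-walk d

  trail-⊆ : ∀ {ts : List A} {hs : List B} m {x y} → TrailFits ts hs m → (x , y) ∈ trail ts hs m → x ∈ ts × y ∈ hs
  trail-⊆ (just w) d i = walk-⊆ d i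

  trail-row : ∀ {ts : List A} {hs : List B} m {x} → TrailFits ts hs m → x ∈ ts → ∃ λ y → (x , y) ∈ trail ts hs m
  trail-row nothing (refl , refl) ()
  trail-row (just w) d i = walk-row d i

  trail-column : ∀ {ts : List A} {hs : List B} m {y} → TrailFits ts hs m → y ∈ hs → ∃ λ x → (x , y) ∈ trail ts hs m
  trail-column nothing (refl , refl) ()
  trail-column (just w) d i = walk-column d i

  module _ {_<₁_ : A → A → Set} {_<₂_ : B → B → Set}
           (asym₁ : ∀ {x y} → x <₁ y → ¬ (y <₁ x)) (asym₂ : ∀ {x y} → x <₂ y → ¬ (y <₂ x))
           {ts : List A} {hs : List B} (sorted₁ : AllPairs _<₁_ ts) (sorted₂ : AllPairs _<₂_ hs) where

    trail-chain : ∀ m → TrailFits ts hs m → Chain _<₁_ _<₂_ (λ x y → (x , y) ∈ trail ts hs m)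
    trail-chain (just w) d i j = walk-chain asym₁ asym₂ sorted₁ sorted₂ d i j

    trail-unique : ∀ m → TrailFits ts hs m → Unique (trail ts hs m)
    trail-unique nothing _ = []
    trail-unique (just w) d = walk-unique asym₁ asym₂ sorted₁ sorted₂ d

    trail-injective : ∀ m m' → TrailFits ts hs m → TrailFits ts hs m' →
      (∀ {a} → a ∈ trail ts hs m → a ∈ trail ts hs m') → (∀ {a} → a ∈ trail ts hs m' → a ∈ trail ts hs m) → m ≡ m'
    trail-injective nothing nothing _ _ _ _ = refl
    trail-injective (just w) (just w') d d' f g = cong just (walk-injective asym₁ asym₂ sorted₁ sorted₂ d d' f g)
    trail-injective nothing (just w) (refl , _) ()
    trail-injective (just w) nothing () (refl , _)

    chain-trail : (S : A → B → Set) → (∀ x y → Dec (S x y)) → Chain _<₁_ _<₂_ S →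
      (∀ {x} → x ∈ ts → ∃ λ y → y ∈ hs × S x y) → (∀ {y} → y ∈ hs → ∃ λ x → x ∈ ts × S x y) →
      ∃ λ m → TrailFits ts hs m × (∀ {x y} → (x , y) ∈ trail ts hs m → S x y) ×
              (∀ {x y} → x ∈ ts → y ∈ hs → S x y → (x , y) ∈ trail ts hs m)
    chain-trail S S? chain row col = go ts hs sorted₁ sorted₂ row col
      where
      go : ∀ ts hs → AllPairs _<₁_ ts → AllPairs _<₂_ hs →
        (∀ {x} → x ∈ ts → ∃ λ y → y ∈ hs × S x y) → (∀ {y} → y ∈ hs → ∃ λ x → x ∈ ts × S x y) →
        ∃ λ m → TrailFits ts hs m × (∀ {x y} → (x , y) ∈ trail ts hs m → S x y) ×
                (∀ {x y} → x ∈ ts → y ∈ hs → S x y → (x , y) ∈ trail ts hs m)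
      go [] [] _ _ _ _ = nothing , (refl , refl) , (λ ()) , (λ ())
      go [] (h ∷ hs) _ _ _ col with col (here refl)
      ... | _ , () , _
      go (t ∷ ts) [] _ _ row _ with row (here refl)
      ... | _ , () , _
      go (t ∷ ts) (h ∷ hs) a b row col = let traces w d f g = chain-traces asym₁ asym₂ S S? chain t ts h hs a b row col
        in just w , d , f , g

-- Edges of the flag complex

-- In types TTHH and HHTT the heads run parallel to the tails in the crossing
-- matching and antiparallel in the nesting one; this is the order on heads that
-- turns either rule into "tails and heads increase together".
precedes : Matching → ℕ → ℕ → Set
precedes nest x y = y < x
precedes _ x y = x < y

precedes? : ∀ r x y → Dec (precedes r x y)
precedes? nest x y = y <? x
precedes? cross x y = x <? y
precedes? separate x y = x <? y

precedes-asym : ∀ r {x y} → precedes r x y → ¬ precedes r y x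
precedes-asym nest = <-asym
precedes-asym cross = <-asym
precedes-asym separate = <-asym

rules : Matching → Matching → RuleSet
rules r s THTH = nest
rules r s HTHT = nest
rules r s THHT = cross
rules r s HTTH = cross
rules r s TTHH = r
rules r s HHTT = s

-- The arrows are a → b and c → d. Only half of the compatibility: it is imposed in both orders.
Agree : Matching → Matching → ℕ → ℕ → ℕ → ℕ → Set
Agree r s a b c d =
  (a < b → c < d → a < d × ¬ (a < c × precedes r d b)) ×
  (b < a → d < c → b < c × ¬ (a < c × precedes s d b)) ×
  (a < b → d < c → a ≤ c × d ≤ b × a ≢ d × b ≢ c)

-- The form `Agree` takes when all four endpoints differ. Its weak inequalities become strict and
-- its disequalities disappear, so it is a Boolean combination of comparisons.
StrictAgree : Matching → Matching → ℕ → ℕ → ℕ → ℕ → Set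
StrictAgree r s a b c d =
  (a < b → c < d → a < d × ¬ (a < c × precedes r d b)) ×
  (b < a → d < c → b < c × ¬ (a < c × precedes s d b)) ×
  (a < b → d < c → a < c × d < b)

strictAgree? : ∀ r s a b c d → Dec (StrictAgree r s a b c d)
strictAgree? r s a b c d =
  ((a <? b) →-dec ((c <? d) →-dec ((a <? d) ×-dec ¬? ((a <? c) ×-dec precedes? r d b)))) ×-dec
  ((b <? a) →-dec ((d <? c) →-dec ((b <? c) ×-dec ¬? ((a <? c) ×-dec precedes? s d b)))) ×-dec
  ((a <? b) →-dec ((d <? c) →-dec ((a <? c) ×-dec (d <? b))))

agree-tail : ∀ r s a b d → Agree r s a b a d
agree-tail r s a b d =
  (λ _ p → p , λ (q , _) → <-irrefl refl q) ,
  (λ p _ → p , λ (q , _) → <-irrefl refl q) ,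
  (λ p q → ≤-refl , <⇒≤ (<-trans q p) , ≢-sym (<⇒≢ q) , ≢-sym (<⇒≢ p))

agree-head : ∀ r s a b c → Agree r s a b c b
agree-head r s a b c =
  (λ p _ → p , λ (_ , q) → precedes-asym r q q) ,
  (λ _ p → p , λ (_ , q) → precedes-asym s q q) ,
  (λ p q → <⇒≤ (<-trans p q) , ≤-refl , <⇒≢ p , <⇒≢ q)

strict⇒agree : ∀ {r s a b c d} → a ≢ d → b ≢ c → StrictAgree r s a b c d → Agree r s a b c d
strict⇒agree ad bc (f , g , h) = f , g , λ p q → let x , y = h p q in <⇒≤ x , <⇒≤ y , ad , bc

agree⇒strict : ∀ {r s a b c d} → a ≢ c → b ≢ d → Agree r s a b c d → StrictAgree r s a b c d
agree⇒strict ac bd (f , g , h) = f , g , λ p q → let x , y , _ = h p q in ≤∧≢⇒< x ac , ≤∧≢⇒< y (≢-sym bd)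

-- Two arrows `a → b` and `b → c` of the same direction would need `b < b`, because forward tails
-- precede forward heads and backward heads precede backward tails. For opposite directions the two
-- disequalities in `Agree` rule the contact out.
¬agree-head-tail : ∀ {r s a b c} → a ≢ b → b ≢ c → Agree r s a b b c → Agree r s b c a b → ⊥
¬agree-head-tail {a = a} {b} {c} ab bc (f , g , h) (f' , g' , h') with <-cmp a b | <-cmp b c
... | tri≈ _ e _ | _ = ab e
... | tri< _ _ _ | tri≈ _ e _ = bc e
... | tri> _ _ _ | tri≈ _ e _ = bc e
... | tri< p _ _ | tri< q _ _ = <-irrefl refl (proj₁ (f' q p))
... | tri> _ _ p | tri> _ _ q = <-irrefl refl (proj₁ (g p q))
... | tri< p _ _ | tri> _ _ q = proj₂ (proj₂ (proj₂ (h p q))) refl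
... | tri> _ _ p | tri< q _ _ = proj₁ (proj₂ (proj₂ (h' q p))) refl

-- `pairType` and `pairMatching` with the four ranks as arguments, so that they can be evaluated
-- once the ranks are sums of comparison bits.
typeOfRanks : ℕ → ℕ → ℕ → ℕ → PairType
typeOfRanks a b c d =
  if tailsAt 0 2 then THTH else
  if tailsAt 1 3 then HTHT else
  if tailsAt 0 3 then THHT else
  if tailsAt 1 2 then HTTH else
  if tailsAt 0 1 then TTHH else HHTT
  where
  tailsAt : ℕ → ℕ → Bool
  tailsAt i j = ((a ≡ᵇ i) ∧ (c ≡ᵇ j)) ∨ ((a ≡ᵇ j) ∧ (c ≡ᵇ i))

matchingOfRanks : ℕ → ℕ → ℕ → ℕ → Matching
matchingOfRanks a b c d =
  if partner ≡ᵇ 1 then separate else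
  if partner ≡ᵇ 2 then cross else nest
  where
  partner : ℕ
  partner = if (a ≡ᵇ 0) then b else if (b ≡ᵇ 0) then a else if (c ≡ᵇ 0) then d else c

ranksMatch : RuleSet → ℕ → ℕ → ℕ → ℕ → Bool
ranksMatch R a b c d = R (typeOfRanks a b c d) ==M matchingOfRanks a b c d

rank≡ : ∀ p a b c d → rank p a b c d ≡ ind (a <ᵇ p) + (ind (b <ᵇ p) + (ind (c <ᵇ p) + ind (d <ᵇ p)))
rank≡ p a b c d with a <ᵇ p | b <ᵇ p | c <ᵇ p | d <ᵇ p
... | true | true | true | true = refl
... | true | true | true | false = refl
... | true | true | false | true = refl
... | true | true | false | false = refl
... | true | false | true | true = refl
... | true | false | true | false = refl
... | true | false | false | true = refl
... | true | false | false | false = refl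
... | false | true | true | true = refl
... | false | true | true | false = refl
... | false | true | false | true = refl
... | false | true | false | false = refl
... | false | false | true | true = refl
... | false | false | true | false = refl
... | false | false | false | true = refl
... | false | false | false | false = refl

<ᵇ-irrefl : ∀ a → (a <ᵇ a) ≡ false
<ᵇ-irrefl zero = refl
<ᵇ-irrefl (suc a) = <ᵇ-irrefl a

<ᵇ-flip : ∀ a b → a ≢ b → (b <ᵇ a) ≡ not (a <ᵇ b)
<ᵇ-flip zero zero ne = ⊥-elim (ne refl)
<ᵇ-flip zero (suc b) ne = refl
<ᵇ-flip (suc a) zero ne = refl
<ᵇ-flip (suc a) (suc b) ne = <ᵇ-flip a b (ne ∘ cong suc)

-- False exactly for the two cyclic outcomes of three comparisons.
transitive : Bool → Bool → Bool → Bool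
transitive xy yz xz = if xy then (if yz then xz else true) else (if yz then true else not xz)

<ᵇ-transitive : ∀ a b c → a ≢ b → b ≢ c → a ≢ c → transitive (a <ᵇ b) (b <ᵇ c) (a <ᵇ c) ≡ true
<ᵇ-transitive zero zero c ab bc ac = ⊥-elim (ab refl)
<ᵇ-transitive zero (suc b) zero ab bc ac = ⊥-elim (ac refl)
<ᵇ-transitive zero (suc b) (suc c) ab bc ac with b <ᵇ c
... | true = refl
... | false = refl
<ᵇ-transitive (suc a) zero zero ab bc ac = ⊥-elim (bc refl)
<ᵇ-transitive (suc a) zero (suc c) ab bc ac = refl
<ᵇ-transitive (suc a) (suc b) zero ab bc ac with a <ᵇ b
... | true = refl
... | false = refl
<ᵇ-transitive (suc a) (suc b) (suc c) ab bc ac = <ᵇ-transitive a b c (ab ∘ cong suc) (bc ∘ cong suc) (ac ∘ cong suc)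

-- The arguments ab, ac, … stand for the truth values of a < b, a < c, …
agreeᵇ : Matching → Matching → (ab ac ad bc bd db cd : Bool) → Bool
agreeᵇ r s ab ac ad bc bd db cd =
  (not ab ∨ (not cd ∨ (ad ∧ not (ac ∧ head-order r)))) ∧
  ((not (not ab) ∨ (not (not cd) ∨ (bc ∧ not (ac ∧ head-order s)))) ∧
   (not ab ∨ (not (not cd) ∨ (ac ∧ db))))
  where
  head-order : Matching → Bool
  head-order nest = bd
  head-order _ = db

-- Each rank is the number of endpoints below the given one; the summands are arranged as `rank≡`
-- leaves them after rewriting.
ranksMatchᵇ : RuleSet → (ab ac ad bc bd cd : Bool) → Bool
ranksMatchᵇ R ab ac ad bc bd cd = ranksMatch R
  (ind (not ab) + (ind (not ac) + ind (not ad))) (ind ab + (ind (not bc) + ind (not bd)))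
  (ind ac + (ind bc + ind (not cd))) (ind ad + (ind bd + (ind cd + 0)))

∀Bool? : {P : Bool → Set} → (∀ b → Dec (P b)) → Dec (∀ b → P b)
∀Bool? P? with P? true | P? false
... | yes t | yes f = yes λ { true → t ; false → f }
... | no ¬t | _ = no λ h → ¬t (h true)
... | yes _ | no ¬f = no λ h → ¬f (h false)

-- Six comparisons among four elements come from a linear order as soon as none of the four triples
-- is cyclic.
linear : (ab ac ad bc bd cd : Bool) → Bool
linear ab ac ad bc bd cd = transitive ab bc ac ∧ (transitive ab bd ad ∧ (transitive ac cd ad ∧ transitive bc cd bd))

MatchesAgree : Matching → Matching → Set
MatchesAgree r s = ∀ ab ac ad bc bd cd → linear ab ac ad bc bd cd ≡ true →
  ranksMatchᵇ (rules r s) ab ac ad bc bd cd ≡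
  agreeᵇ r s ab ac ad bc bd (not bd) cd ∧ agreeᵇ r s cd (not ac) (not bc) (not ad) (not bd) bd ab

matchesAgree? : ∀ r s → Dec (MatchesAgree r s)
matchesAgree? r s = ∀Bool? λ ab → ∀Bool? λ ac → ∀Bool? λ ad → ∀Bool? λ bc → ∀Bool? λ bd → ∀Bool? λ cd →
  (linear ab ac ad bc bd cd ≟ᵇ true) →-dec (_ ≟ᵇ _)

-- Proved by evaluation: for each of the four choices of the free rules, the 64 bit patterns are run
-- through, 24 of which are linear orders. This is the only place where the rule table is compared
-- with the inequalities.
matchesAgree : ∀ {r s} → Allowed TTHH r → Allowed HHTT s → MatchesAgree r s
matchesAgree tthh-nest hhtt-nest = toWitness {a? = matchesAgree? nest nest} tt
matchesAgree tthh-nest hhtt-cross = toWitness {a? = matchesAgree? nest cross} tt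
matchesAgree tthh-cross hhtt-nest = toWitness {a? = matchesAgree? cross nest} tt
matchesAgree tthh-cross hhtt-cross = toWitness {a? = matchesAgree? cross cross} tt

module _ {r s : Matching} {a b c d : ℕ} (ok : Allowed TTHH r) (ok' : Allowed HHTT s)
         (ab : a ≢ b) (ac : a ≢ c) (ad : a ≢ d) (bc : b ≢ c) (bd : b ≢ d) (cd : c ≢ d) where

  private
    linear-true : linear (a <ᵇ b) (a <ᵇ c) (a <ᵇ d) (b <ᵇ c) (b <ᵇ d) (c <ᵇ d) ≡ true
    linear-true rewrite <ᵇ-transitive a b c ab bc ac | <ᵇ-transitive a b d ab bd ad
                      | <ᵇ-transitive a c d ac cd ad | <ᵇ-transitive b c d bc cd bd = refl

    ranksMatch≡ : ranksMatch (rules r s) (rank a a b c d) (rank b a b c d) (rank c a b c d) (rank d a b c d) ≡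
      ranksMatchᵇ (rules r s) (a <ᵇ b) (a <ᵇ c) (a <ᵇ d) (b <ᵇ c) (b <ᵇ d) (c <ᵇ d)
    ranksMatch≡
      rewrite rank≡ a a b c d | rank≡ b a b c d | rank≡ c a b c d | rank≡ d a b c d
          | <ᵇ-irrefl a | <ᵇ-irrefl b | <ᵇ-irrefl c | <ᵇ-irrefl d
          | <ᵇ-flip a b ab | <ᵇ-flip a c ac | <ᵇ-flip a d ad | <ᵇ-flip b c bc | <ᵇ-flip b d bd | <ᵇ-flip c d cd = refl

    agreeᵇ-does : does (strictAgree? r s a b c d ×-dec strictAgree? r s c d a b) ≡
      agreeᵇ r s (a <ᵇ b) (a <ᵇ c) (a <ᵇ d) (b <ᵇ c) (b <ᵇ d) (not (b <ᵇ d)) (c <ᵇ d) ∧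
      agreeᵇ r s (c <ᵇ d) (not (a <ᵇ c)) (not (b <ᵇ c)) (not (a <ᵇ d)) (not (b <ᵇ d)) (b <ᵇ d) (a <ᵇ b)
    agreeᵇ-does = helper ok ok'
      where
      -- The rules are quantified again so that they can be matched on: once both are concrete,
      -- `precedes` and its Boolean counterpart reduce to the same comparison.
      helper : ∀ {r s} → Allowed TTHH r → Allowed HHTT s → does (strictAgree? r s a b c d ×-dec strictAgree? r s c d a b) ≡
        agreeᵇ r s (a <ᵇ b) (a <ᵇ c) (a <ᵇ d) (b <ᵇ c) (b <ᵇ d) (not (b <ᵇ d)) (c <ᵇ d) ∧
        agreeᵇ r s (c <ᵇ d) (not (a <ᵇ c)) (not (b <ᵇ c)) (not (a <ᵇ d)) (not (b <ᵇ d)) (b <ᵇ d) (a <ᵇ b)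
      helper tthh-nest hhtt-nest
        rewrite <ᵇ-flip a b ab | <ᵇ-flip a c ac | <ᵇ-flip a d ad | <ᵇ-flip b c bc | <ᵇ-flip b d bd | <ᵇ-flip c d cd = refl
      helper tthh-nest hhtt-cross
        rewrite <ᵇ-flip a b ab | <ᵇ-flip a c ac | <ᵇ-flip a d ad | <ᵇ-flip b c bc | <ᵇ-flip b d bd | <ᵇ-flip c d cd = refl
      helper tthh-cross hhtt-nest
        rewrite <ᵇ-flip a b ab | <ᵇ-flip a c ac | <ᵇ-flip a d ad | <ᵇ-flip b c bc | <ᵇ-flip b d bd | <ᵇ-flip c d cd = refl
      helper tthh-cross hhtt-cross
        rewrite <ᵇ-flip a b ab | <ᵇ-flip a c ac | <ᵇ-flip a d ad | <ᵇ-flip b c bc | <ᵇ-flip b d bd | <ᵇ-flip c d cd = refl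

  ranksMatch-does : ranksMatch (rules r s) (rank a a b c d) (rank b a b c d) (rank c a b c d) (rank d a b c d) ≡
    does (strictAgree? r s a b c d ×-dec strictAgree? r s c d a b)
  ranksMatch-does = trans ranksMatch≡ (trans 
    (matchesAgree ok ok' (a <ᵇ b) (a <ᵇ c) (a <ᵇ d) (b <ᵇ c) (b <ᵇ d) (c <ᵇ d) linear-true) (sym agreeᵇ-does))

does-sound : {P : Set} (P? : Dec P) → T (does P?) → P
does-sound (yes p) _ = p

does-complete : {P : Set} (P? : Dec P) → P → T (does P?)
does-complete (yes _) _ = tt
does-complete (no ¬p) p = ¬p p

≡ᵇ-refl : ∀ a → (a ≡ᵇ a) ≡ true
≡ᵇ-refl a = Equivalence.to T-≡ (≡⇒≡ᵇ a a refl)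

≢⇒≡ᵇ-false : ∀ {a b} → a ≢ b → (a ≡ᵇ b) ≡ false
≢⇒≡ᵇ-false {a} {b} ne with a ≡ᵇ b in e
... | false = refl
... | true = ⊥-elim (ne (≡ᵇ⇒≡ a b (Equivalence.from T-≡ e)))

module _ {R : RuleSet} {r s : Matching} (ok : Allowed TTHH r) (ok' : Allowed HHTT s) (R≗ : (t : PairType) → R t ≡ rules r s t) where

  Compatible : ∀ {n} → Arrow n → Arrow n → Set
  Compatible u v = Agree r s (tail u) (head u) (tail v) (head v) × Agree r s (tail v) (head v) (tail u) (head u)

  private
    touching : ∀ {n} (u v : Arrow n) → tail u ≢ tail v → head u ≢ head v → tail u ≡ head v ⊎ head u ≡ tail v → edge R u v ≡ false
    touching u v ac bd (inj₁ ad) rewrite ≢⇒≡ᵇ-false ac | ≢⇒≡ᵇ-false bd | ad | ≡ᵇ-refl (head v) = refl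
    touching u v ac bd (inj₂ bc) rewrite ≢⇒≡ᵇ-false ac | ≢⇒≡ᵇ-false bd | bc | ≡ᵇ-refl (tail v) with tail u ≡ᵇ head v
    ... | true = refl
    ... | false = refl

    apart : ∀ {n} (u v : Arrow n) → tail u ≢ head u → tail v ≢ head v → tail u ≢ tail v → head u ≢ head v →
      tail u ≢ head v → head u ≢ tail v →
      edge R u v ≡ does (strictAgree? r s (tail u) (head u) (tail v) (head v)
                         ×-dec strictAgree? r s (tail v) (head v) (tail u) (head u))
    apart u v ab cd ac bd ad bc = trans step (trans (cong (_==M _) (R≗ _)) (ranksMatch-does ok ok' ab ac ad bc bd cd))
      where
      step : edge R u v ≡ (R (pairType u v) ==M pairMatching u v)
      step rewrite ≢⇒≡ᵇ-false ac | ≢⇒≡ᵇ-false bd | ≢⇒≡ᵇ-false ad | ≢⇒≡ᵇ-false bc = refl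

  -- A common tail or a common head makes arrows agree outright. Otherwise a head of one arrow at
  -- the tail of the other is not an edge, so the four endpoints are distinct and the comparison
  -- table applies.
  edge⇒compatible : ∀ {n} (u v : Arrow n) → tail u ≢ head u → tail v ≢ head v → T (edge R u v) → Compatible u v
  edge⇒compatible u v ab cd e with tail u ≟ tail v | head u ≟ head v
  ... | yes ac | _ = subst (λ x → Agree r s (tail u) (head u) x (head v) × Agree r s x (head v) (tail u) (head u)) ac
                       (agree-tail r s _ _ _ , agree-tail r s _ _ _)
  ... | no _ | yes bd = subst (λ x → Agree r s (tail u) (head u) (tail v) x × Agree r s (tail v) x (tail u) (head u)) bd
                       (agree-head r s _ _ _ , agree-head r s _ _ _)
  ... | no ac | no bd = go (tail u ≟ head v) (head u ≟ tail v)
    where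
    go : Dec (tail u ≡ head v) → Dec (head u ≡ tail v) → Compatible u v
    go (yes ad) _ = ⊥-elim (subst T (touching u v ac bd (inj₁ ad)) e)
    go (no _) (yes bc) = ⊥-elim (subst T (touching u v ac bd (inj₂ bc)) e)
    go (no ad) (no bc) =
      let p , q = does-sound (strictAgree? r s _ _ _ _ ×-dec strictAgree? r s _ _ _ _) (subst T (apart u v ab cd ac bd ad bc) e)
      in strict⇒agree ad bc p , strict⇒agree (≢-sym bc) (≢-sym ad) q

  compatible⇒edge : ∀ {n} (u v : Arrow n) → tail u ≢ head u → tail v ≢ head v → u ≢ v → Compatible u v → T (edge R u v)
  compatible⇒edge u v ab cd uv (p , q) with tail u ≟ tail v | head u ≟ head v
  ... | yes ac | yes bd = ⊥-elim (uv (cong₂ _,_ (toℕ-injective ac) (toℕ-injective bd)))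
  ... | yes ac | no bd rewrite ac | ≢⇒≡ᵇ-false bd | ≡ᵇ-refl (tail v) = tt
  ... | no ac | yes bd rewrite bd | ≢⇒≡ᵇ-false ac | ≡ᵇ-refl (head v) = tt
  ... | no ac | no bd = go (tail u ≟ head v) (head u ≟ tail v)
    where
    go : Dec (tail u ≡ head v) → Dec (head u ≡ tail v) → T (edge R u v)
    go (yes ad) _ = ⊥-elim (¬agree-head-tail cd (≢-sym bd)
      (subst (λ x → Agree r s _ _ x _) ad q) (subst (λ x → Agree r s x _ _ _) ad p))
    go (no _) (yes bc) = ⊥-elim (¬agree-head-tail ab bd
      (subst (λ x → Agree r s _ _ x _) (sym bc) p) (subst (λ x → Agree r s x _ _ _) (sym bc) q))
    go (no ad) (no bc) = subst T (sym (apart u v ab cd ac bd ad bc))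
      (does-complete (strictAgree? r s _ _ _ _ ×-dec strictAgree? r s _ _ _ _) (agree⇒strict ac bd p , agree⇒strict (≢-sym ac) (≢-sym bd) q))

-- Words of vertex labels

-- A vertex is a tail (true) or a head (false). It lies on the left if it is the
-- tail of a forward arrow or the head of a backward one, and on the right if it
-- is the head of a forward arrow or the tail of a backward one.
data Side : Set where
  left middle right : Side

Letter : Set
Letter = Bool × Side

leftish rightish : Letter → Bool
leftish (_ , right) = false
leftish _ = true
rightish (_ , left) = false
rightish _ = true

fwdTail fwdHead bwdTail bwdHead : Letter → Bool
fwdTail (true , s) = leftish (true , s)
fwdTail (false , _) = false
fwdHead (true , _) = false
fwdHead (false , s) = rightish (false , s)
bwdTail (true , s) = rightish (true , s)
bwdTail (false , _) = false
bwdHead (true , _) = false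
bwdHead (false , s) = leftish (false , s)

-- A middle letter is both leftish and rightish, so pairwise this relation allows at most one of
-- them and puts it between the left and the right letters.
Before : Letter → Letter → Set
Before x y = T (rightish x) → ¬ T (leftish y)

countB-++ : {A : Set} (p : A → Bool) (xs ys : List A) → countB p (xs ++ ys) ≡ countB p xs + countB p ys
countB-++ p [] ys = refl
countB-++ p (x ∷ xs) ys with p x
... | true = cong suc (countB-++ p xs ys)
... | false = countB-++ p xs ys

countB-map : {A B : Set} (p : B → Bool) (f : A → B) (xs : List A) → countB p (map f xs) ≡ countB (p ∘ f) xs
countB-map p f [] = refl
countB-map p f (x ∷ xs) with p (f x)
... | true = cong suc (countB-map p f xs)
... | false = countB-map p f xs

countB-cong : {A : Set} {p q : A → Bool} → (∀ x → p x ≡ q x) → (xs : List A) → countB p xs ≡ countB q xs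
countB-cong e [] = refl
countB-cong {p = p} {q} e (x ∷ xs) with p x | q x | e x
... | true | _ | refl = cong suc (countB-cong e xs)
... | false | _ | refl = countB-cong e xs

countB-none : {A : Set} (xs : List A) → countB (λ _ → false) xs ≡ 0
countB-none [] = refl
countB-none (x ∷ xs) = countB-none xs

-- Binary words and binomial coefficients

Balanced : ℕ → ℕ → List Bool → Set
Balanced p q l = countB id l ≡ p × countB not l ≡ q

balanced-length : ∀ {p q} l → Balanced p q l → length l ≡ p + q
balanced-length [] (refl , refl) = refl
balanced-length (true ∷ l) (refl , refl) = cong suc (balanced-length l (refl , refl))
balanced-length (false ∷ l) (refl , refl) = trans (cong suc (balanced-length l (refl , refl))) (sym (+-suc _ _))

nC0≡1 : ∀ n → n C 0 ≡ 1
nC0≡1 n = trans (nCk≡nC[n∸k] {0} {n} z≤n) (nCn≡1 n)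

-- Splitting by the first letter is Pascal's rule; if one letter is absent only the constant word
-- remains.
count-balanced : ∀ p q → Counts (Balanced p q) ((p + q) C p)
count-balanced zero zero = counts-singleton [] (refl , refl)
  λ { {[]} _ → refl ; {true ∷ _} (() , _) ; {false ∷ _} (_ , ()) }
count-balanced zero (suc q) = subst (Counts _) (trans (nC0≡1 q) (sym (nC0≡1 (suc q)))) (counts-image (false ∷_)
  (λ _ _ e → proj₂ (∷-injective e)) (λ (e , e') → e , cong suc e')
  (λ { {true ∷ _} (() , _) ; {false ∷ l} (e , e') → l , (e , suc-injective e') , refl }) (count-balanced zero q))
count-balanced (suc p) zero = subst (Counts _) (trans (diagonal p) (sym (diagonal (suc p)))) (counts-image (true ∷_)
  (λ _ _ e → proj₂ (∷-injective e)) (λ (e , e') → cong suc e , e')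
  (λ { {false ∷ _} (_ , ()) ; {true ∷ l} (e , e') → l , (suc-injective e , e') , refl }) (count-balanced p zero))
  where
  diagonal : ∀ k → (k + 0) C k ≡ 1
  diagonal k = trans (cong (_C k) (+-identityʳ k)) (nCn≡1 k)
count-balanced (suc p) (suc q) = subst (Counts _) pascal (counts-⇔
  {P = λ l → (∃ λ l' → Balanced p (suc q) l' × true ∷ l' ≡ l) ⊎ (∃ λ l' → Balanced (suc p) q l' × false ∷ l' ≡ l)}
  (λ { (inj₁ (_ , (e , e') , refl)) → cong suc e , e' ; (inj₂ (_ , (e , e') , refl)) → e , cong suc e' })
  (λ { {true ∷ l} (e , e') → inj₁ (l , (suc-injective e , e') , refl)
     ; {false ∷ l} (e , e') → inj₂ (l , (e , suc-injective e') , refl) })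
  (counts-⊎
    (counts-image (true ∷_) (λ _ _ e → proj₂ (∷-injective e)) (λ b → _ , b , refl) id (count-balanced p (suc q)))
    (counts-image (false ∷_) (λ _ _ e → proj₂ (∷-injective e)) (λ b → _ , b , refl) id (count-balanced (suc p) q))
    λ { (_ , _ , refl) (_ , _ , ()) }))
  where
  pascal : (p + suc q) C p + (suc p + q) C suc p ≡ (suc p + suc q) C suc p
  pascal = trans (cong (λ k → (p + suc q) C p + k C suc p) (sym (+-suc p q))) (nCk+nC[k+1]≡[n+1]C[k+1] (p + suc q) p)

-- The complementary binomial, kept separately because the factors of `C₁` and `C₀` select sometimes
-- the tails and sometimes the heads.
count-balanced′ : ∀ p q → Counts (Balanced p q) ((p + q) C q)
count-balanced′ p q = subst (Counts _)
  (sym (trans (nCk≡nC[n∸k] (m≤n+m q p)) (cong ((p + q) C_) (m+n∸n≡m p q)))) (count-balanced p q)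

-- Valid words, cut at the junction of the two groups

encode : List Bool → List Letter → List Bool → List Letter
encode l mid r = map (_, left) l ++ mid ++ map (_, right) r

encode-injective : ∀ {l l'} mid {r r'} → length l ≡ length l' → encode l mid r ≡ encode l' mid r' → l ≡ l' × r ≡ r'
encode-injective {[]} {[]} mid _ e = refl , rights mid e
  where
  rights : ∀ mid {r r'} → mid ++ map (_, right) r ≡ mid ++ map (_, right) r' → r ≡ r'
  rights (_ ∷ mid) e = rights mid (proj₂ (∷-injective e))
  rights [] {[]} {[]} e = refl
  rights [] {x ∷ r} {y ∷ r'} e with ∷-injective e
  ... | refl , e' = cong (x ∷_) (rights [] e')
encode-injective {x ∷ l} {y ∷ l'} mid n e with ∷-injective e
... | refl , e' = let a , b = encode-injective mid (suc-injective n) e' in cong (x ∷_) a , b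

length-encode : ∀ l mid r → length (encode l mid r) ≡ length l + (length mid + length r)
length-encode l mid r = trans (length-++ (map (_, left) l)) (cong₂ _+_ (length-map (_, left) l)
  (trans (length-++ mid) (cong (length mid +_) (length-map (_, right) r))))

-- Left of the junction stand `p` forward tails and `s` backward heads, right of it `r` backward
-- tails and `q` forward heads. A junction letter is counted in none of the four.
Split : List Letter → (p s r q : ℕ) → ∀ {N} → Vec Letter N → Set
Split mid p s r q W = ∃₂ λ l l' → Balanced p s l × Balanced r q l' × toList W ≡ encode l mid l'

-- truncates or pads xs unless N ≡ length xs
toVec : ∀ N → List Letter → Vec Letter N
toVec zero _ = Vec.[]
toVec (suc N) [] = (true , left) Vec.∷ toVec N []
toVec (suc N) (x ∷ xs) = x Vec.∷ toVec N xs

toList∘toVec : ∀ {N} xs → length xs ≡ N → toList (toVec N xs) ≡ xs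
toList∘toVec [] refl = refl
toList∘toVec (x ∷ xs) refl = cong (x ∷_) (toList∘toVec xs refl)

toList-inj : ∀ {N} (V W : Vec Letter N) → toList V ≡ toList W → V ≡ W
toList-inj Vec.[] Vec.[] _ = refl
toList-inj (x Vec.∷ V) (y Vec.∷ W) e with ∷-injective e
... | refl , e' = cong (x Vec.∷_) (toList-inj V W e')

-- The two groups are arranged independently, and the length of the vector forces the size equation
-- in the indicator. The factors `cₗ` and `cᵣ` are arguments so that each binomial can be taken in
-- either of its two forms.
count-split : ∀ mid p s r q {cₗ cᵣ} N → Counts (Balanced p s) cₗ → Counts (Balanced r q) cᵣ →
  Counts (Split mid p s r q {N}) (ind ((p + s) + (length mid + (r + q)) ≡ᵇ N) * (cₗ * cᵣ))
count-split mid p s r q {cₗ} {cᵣ} N count count' = counts-ind _ (λ t → go (≡ᵇ⇒≡ ((p + s) + (length mid + (r + q))) N t))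
  (λ {W} (l , l' , b , b' , e) → ≡⇒≡ᵇ _ N (trans (sym (size l l' b b')) (trans (cong length (sym e)) (length-toList W))))
  where
  size : ∀ l l' → Balanced p s l → Balanced r q l' → length (encode l mid l') ≡ (p + s) + (length mid + (r + q))
  size l l' b b' = trans (length-encode l mid l')
    (cong₂ (λ x y → x + (length mid + y)) (balanced-length l b) (balanced-length l' b'))
  go : (p + s) + (length mid + (r + q)) ≡ N → Counts (Split mid p s r q {N}) (cₗ * cᵣ)
  go eq = counts-image (λ (l , l') → toVec N (encode l mid l'))
    (λ {(l , l')} {(k , k')} (b , b') (c , c') e →
      let x , y = encode-injective mid (trans (balanced-length l b) (sym (balanced-length k c)))
                    (trans (sym (toList∘toVec _ (trans (size l l' b b') eq)))
                      (trans (cong toList e) (toList∘toVec _ (trans (size k k' c c') eq))))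
      in cong₂ _,_ x y)
    (λ {(l , l')} (b , b') → l , l' , b , b' , toList∘toVec _ (trans (size l l' b b') eq))
    (λ (l , l' , b , b' , e) → (l , l') , (b , b') ,
      toList-inj _ _ (trans (toList∘toVec _ (trans (size l l' b b') eq)) (sym e)))
    (counts-× count count')

-- In `shared true` the middle vertex is the tail of a forward and of a backward arrow, in
-- `shared false` the head of both.
data Junction : List Letter → Set where
  none : Junction []
  shared : ∀ b → Junction ((b , middle) ∷ [])

Valid : List Letter → Set
Valid = AllPairs Before

rights : ∀ xs → All (λ x → ¬ T (leftish x)) xs → ∃ λ r → xs ≡ map (_, right) r
rights [] _ = [] , refl
rights ((b , right) ∷ xs) (_ ∷ a) = let r , e = rights xs a in b ∷ r , cong (_ ∷_) e
rights ((b , left) ∷ xs) (n ∷ _) = ⊥-elim (n tt)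
rights ((b , middle) ∷ xs) (n ∷ _) = ⊥-elim (n tt)

-- The first letter that is not `left` is rightish, hence no later letter is leftish and the
-- remainder of the word is `right` throughout.
valid⇒encode : ∀ xs → Valid xs → ∃ λ l → ∃ λ mid → ∃ λ r → Junction mid × xs ≡ encode l mid r
valid⇒encode [] _ = [] , [] , [] , none , refl
valid⇒encode ((b , left) ∷ xs) (_ ∷ v) =
  let l , mid , r , j , e = valid⇒encode xs v in b ∷ l , mid , r , j , cong (_ ∷_) e
valid⇒encode ((b , middle) ∷ xs) (a ∷ _) =
  let r , e = rights xs (All.map (λ f → f tt) a) in [] , _ , r , shared b , cong (_ ∷_) e
valid⇒encode ((b , right) ∷ xs) (a ∷ _) =
  let r , e = rights xs (All.map (λ f → f tt) a) in [] , [] , b ∷ r , none , cong (_ ∷_) e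

encode-valid : ∀ l {mid} r → Junction mid → Valid (encode l mid r)
encode-valid (b ∷ l) r j = All.tabulate (λ _ ()) ∷ encode-valid l r j
encode-valid [] r none = rights-valid r
  where
  rights-valid : ∀ r → Valid (map (_, right) r)
  rights-valid [] = []
  rights-valid (b ∷ r) = All.map⁺ (All.tabulate (λ _ _ ())) ∷ rights-valid r
encode-valid [] r (shared b) = All.map⁺ (All.tabulate (λ _ _ ())) ∷ encode-valid [] r none

count-encode : ∀ p l mid r → countB p (encode l mid r) ≡
  countB (p ∘ (_, left)) l + (countB p mid + countB (p ∘ (_, right)) r)
count-encode p l mid r = trans (countB-++ p (map (_, left) l) _) (cong₂ _+_ (countB-map p (_, left) l)
  (trans (countB-++ p mid _) (cong (countB p mid +_) (countB-map p (_, right) r))))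

module _ (l : List Bool) (mid : List Letter) (r : List Bool) where

  private
    word = encode l mid r

  fwdTail-encode : countB fwdTail word ≡ countB id l + countB fwdTail mid
  fwdTail-encode = trans (count-encode fwdTail l mid r) (cong₂ _+_
    (countB-cong (λ { true → refl ; false → refl }) l)
    (trans (cong (countB fwdTail mid +_) (trans (countB-cong (λ { true → refl ; false → refl }) r) (countB-none r)))
      (+-identityʳ _)))

  fwdHead-encode : countB fwdHead word ≡ countB fwdHead mid + countB not r
  fwdHead-encode = trans (count-encode fwdHead l mid r) (cong₂ _+_
    (trans (countB-cong (λ { true → refl ; false → refl }) l) (countB-none l))
    (cong (countB fwdHead mid +_) (countB-cong (λ { true → refl ; false → refl }) r)))

  bwdTail-encode : countB bwdTail word ≡ countB bwdTail mid + countB id r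
  bwdTail-encode = trans (count-encode bwdTail l mid r) (cong₂ _+_
    (trans (countB-cong (λ { true → refl ; false → refl }) l) (countB-none l))
    (cong (countB bwdTail mid +_) (countB-cong (λ { true → refl ; false → refl }) r)))

  bwdHead-encode : countB bwdHead word ≡ countB not l + countB bwdHead mid
  bwdHead-encode = trans (count-encode bwdHead l mid r) (cong₂ _+_
    (countB-cong (λ { true → refl ; false → refl }) l)
    (trans (cong (countB bwdHead mid +_) (trans (countB-cong (λ { true → refl ; false → refl }) r) (countB-none r)))
      (+-identityʳ _)))

LetterCounts : (p q r s : ℕ) → List Letter → Set
LetterCounts p q r s xs = countB fwdTail xs ≡ p × countB fwdHead xs ≡ q × countB bwdTail xs ≡ r × countB bwdHead xs ≡ s

Word : (p q r s : ℕ) → ∀ {N} → Vec Letter N → Set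
Word p q r s W = Valid (toList W) × LetterCounts p q r s (toList W)

counts-encode : ∀ l mid r → LetterCounts (countB id l + countB fwdTail mid) (countB fwdHead mid + countB not r)
  (countB bwdTail mid + countB id r) (countB not l + countB bwdHead mid) (encode l mid r)
counts-encode l mid r = fwdTail-encode l mid r , fwdHead-encode l mid r , bwdTail-encode l mid r , bwdHead-encode l mid r

split⇒word : ∀ {mid p s r q N} {W : Vec Letter N} → Junction mid → Split mid p s r q W →
  Word (p + countB fwdTail mid) (countB fwdHead mid + q) (countB bwdTail mid + r) (s + countB bwdHead mid) W
split⇒word {mid} {W = W} j (l , l' , (refl , refl) , (refl , refl) , e) =
  subst Valid (sym e) (encode-valid l l' j) , subst (LetterCounts _ _ _ _) (sym e) (counts-encode l mid l')

word⇒split : ∀ {p q r s N} {W : Vec Letter N} → Word p q r s W →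
  ∃ λ mid → Junction mid × ∃₂ λ p' q' → ∃₂ λ r' s' → Split mid p' s' r' q' W ×
    p ≡ p' + countB fwdTail mid × q ≡ countB fwdHead mid + q' × r ≡ countB bwdTail mid + r' × s ≡ s' + countB bwdHead mid
word⇒split {W = W} (v , refl , refl , refl , refl) with valid⇒encode (toList W) v
... | l , mid , l' , j , e =
  let a , b , c , d = subst (LetterCounts _ _ _ _) (sym e) (counts-encode l mid l')
  in mid , j , _ , _ , _ , _ , (l , l' , (refl , refl) , (refl , refl) , e) , a , b , c , d

-- The numbers of middle tails and of middle heads are invariants of the word; they tell the three
-- kinds of junction apart.
isMiddle : Bool → Letter → Bool
isMiddle true (true , middle) = true
isMiddle false (false , middle) = true
isMiddle _ _ = false

split-middle : ∀ b {mid p s r q N} {W : Vec Letter N} → Split mid p s r q W →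
  countB (isMiddle b) (toList W) ≡ countB (isMiddle b) mid
split-middle b {mid} (l , l' , _ , _ , e) = trans (cong (countB (isMiddle b)) e) (trans (count-encode (isMiddle b) l mid l')
  (trans (cong₂ (λ x y → x + (countB (isMiddle b) mid + y))
    (trans (countB-cong (off b) l) (countB-none l)) (trans (countB-cong (off' b) l') (countB-none l')))
  (+-identityʳ _)))
  where
  off : ∀ b x → isMiddle b (x , left) ≡ false
  off true true = refl
  off true false = refl
  off false true = refl
  off false false = refl
  off' : ∀ b x → isMiddle b (x , right) ≡ false
  off' true true = refl
  off' true false = refl
  off' false true = refl
  off' false false = refl

not-both-suc : ∀ {x y x' y'} → x ≡ 0 ⊎ y ≡ 0 → x ≡ suc x' → y ≡ suc y' → ⊥
not-both-suc (inj₁ refl) ()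
not-both-suc (inj₂ refl) _ ()

-- A shared tail is counted in both `p` and `r`, a shared head in both `q` and `s`; the hypotheses
-- therefore leave only the empty junction.
count-word-unshared : ∀ p q r s N → p ≡ 0 ⊎ r ≡ 0 → q ≡ 0 ⊎ s ≡ 0 →
  Counts (Word p q r s {N}) (ind (p + s + (r + q) ≡ᵇ N) * (((p + s) C p) * ((r + q) C q)))
count-word-unshared p q r s N pr qs = counts-⇔ to from
  (count-split [] p s r q N (count-balanced p s) (count-balanced′ r q))
  where
  to : ∀ {W : Vec Letter N} → Split [] p s r q W → Word p q r s W
  to {W} sp = subst₂ (λ x y → Word x q r y W) (+-identityʳ p) (+-identityʳ s) (split⇒word none sp)
  from : ∀ {W : Vec Letter N} → Word p q r s W → Split [] p s r q W
  from {W} w with word⇒split w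
  ... | _ , none , p' , _ , _ , s' , sp , e , refl , refl , e' =
    subst₂ (λ x y → Split [] x y r q W) (trans (sym (+-identityʳ p')) (sym e)) (trans (sym (+-identityʳ s')) (sym e')) sp
  ... | _ , shared true , p' , _ , _ , _ , _ , e , _ , e' , _ = ⊥-elim (not-both-suc pr (trans e (+-comm p' 1)) e')
  ... | _ , shared false , _ , _ , _ , s' , _ , _ , e , _ , e' = ⊥-elim (not-both-suc qs e (trans e' (+-comm s' 1)))

-- With one direction each group consists of a single kind of letter, so there is one word, of
-- `(a + 1) + (b + 1) = n + 1` letters. This gives coefficient 1 in the terms without $xy$.
count-word-forward : ∀ a b n → Counts (Word (suc a) (suc b) 0 0 {suc n}) (ind (a + b + 1 ≡ᵇ n))
count-word-forward a b n = subst (Counts _)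
  (trans (cong₂ _*_ (cong (λ k → ind (k ≡ᵇ n)) size)
    (cong₂ _*_ (trans (cong (_C suc a) (+-identityʳ (suc a))) (nCn≡1 (suc a))) (nCn≡1 (suc b)))) (*-identityʳ _))
  (count-word-unshared (suc a) (suc b) 0 0 (suc n) (inj₂ refl) (inj₂ refl))
  where
  size : a + 0 + (0 + suc b) ≡ a + b + 1
  size = trans (cong (_+ suc b) (+-identityʳ a)) (trans (+-suc a b) (+-comm 1 (a + b)))

count-word-backward : ∀ a b n → Counts (Word 0 0 (suc a) (suc b) {suc n}) (ind (a + b + 1 ≡ᵇ n))
count-word-backward a b n = subst (Counts _)
  (trans (cong₂ _*_ (cong (λ k → ind (k ≡ᵇ n)) size)
    (cong₂ _*_ (nC0≡1 (suc b)) (nC0≡1 (suc a + 0)))) (*-identityʳ _))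
  (count-word-unshared 0 0 (suc a) (suc b) (suc n) (inj₁ refl) (inj₁ refl))
  where
  size : b + (suc a + 0) ≡ a + b + 1
  size = trans (cong (b +_) (+-identityʳ (suc a))) (trans (+-comm b (suc a)) (+-comm 1 (a + b)))

size-unshared : ∀ a b c d → suc a + suc d + (suc c + suc b) ≡ suc (a + b + c + d + 2 + 1)
size-unshared = solve-∀

size-sharedHead : ∀ a b c d → suc a + d + suc (suc c + b) ≡ suc (a + b + c + d + 2)
size-sharedHead = solve-∀

size-sharedTail : ∀ a b c d → a + suc d + suc (c + suc b) ≡ suc (a + b + c + d + 2)
size-sharedTail = solve-∀

suc+suc : ∀ a b → suc a + suc b ≡ a + b + 2
suc+suc = solve-∀

suc+ : ∀ a b → suc a + b ≡ a + b + 1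
suc+ = solve-∀

+suc : ∀ a b → a + suc b ≡ a + b + 1
+suc = solve-∀

-- A shared head serves as one forward head and one backward head, which shortens both groups by one
-- and the word by one vertex; likewise for a shared tail. Hence `C₀` comes with one power of $z$
-- less than `C₁`.
count-word : ∀ a' b' a'' b'' n → Counts (Word (suc a') (suc b') (suc a'') (suc b'') {suc n})
  (ind (a' + b' + a'' + b'' + 2 + 1 ≡ᵇ n) * C₁ a' b' a'' b'' + ind (a' + b' + a'' + b'' + 2 ≡ᵇ n) * C₀ a' b' a'' b'')
count-word a' b' a'' b'' n = subst (Counts _) (cong₂ _+_ unshared
    (trans (cong₂ _+_ sharedHead sharedTail) (sym (*-distribˡ-+ (ind (a' + b' + a'' + b'' + 2 ≡ᵇ n)) _ _))))
  (counts-⇔ to from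
    (counts-⊎ (count-split [] (suc a') (suc b'') (suc a'') (suc b') (suc n) (count-balanced (suc a') (suc b'')) (count-balanced′ (suc a'') (suc b')))
      (counts-⊎ (count-split ((false , middle) ∷ []) (suc a') b'' (suc a'') b' (suc n) (count-balanced′ (suc a') b'') (count-balanced′ (suc a'') b'))
        (count-split ((true , middle) ∷ []) a' (suc b'') a'' (suc b') (suc n) (count-balanced a' (suc b'')) (count-balanced a'' (suc b')))
        (λ s t → clash true s t λ ()))
      (λ { s (inj₁ t) → clash false s t (λ ()) ; s (inj₂ t) → clash true s t (λ ()) })))
  where
  clash : ∀ b {mid mid' p s r q p' s' r' q' N} {W : Vec Letter N} → Split mid p s r q W → Split mid' p' s' r' q' W →
    countB (isMiddle b) mid ≢ countB (isMiddle b) mid' → ⊥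
  clash b s t ne = ne (trans (sym (split-middle b s)) (split-middle b t))
  unshared : ind (suc a' + suc b'' + (suc a'' + suc b') ≡ᵇ suc n) * (((suc a' + suc b'') C suc a') * ((suc a'' + suc b') C suc b'))
    ≡ ind (a' + b' + a'' + b'' + 2 + 1 ≡ᵇ n) * C₁ a' b' a'' b''
  unshared = cong₂ _*_ (cong (λ k → ind (k ≡ᵇ suc n)) (size-unshared a' b' a'' b''))
    (cong₂ _*_ (cong₂ _C_ (suc+suc a' b'') (+-comm 1 a')) (cong₂ _C_ (suc+suc a'' b') (+-comm 1 b')))
  sharedHead : ind (suc a' + b'' + suc (suc a'' + b') ≡ᵇ suc n) * (((suc a' + b'') C b'') * ((suc a'' + b') C b'))
    ≡ ind (a' + b' + a'' + b'' + 2 ≡ᵇ n) * (((a' + b'' + 1) C b'') * ((a'' + b' + 1) C b'))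
  sharedHead = cong₂ _*_ (cong (λ k → ind (k ≡ᵇ suc n)) (size-sharedHead a' b' a'' b''))
    (cong₂ _*_ (cong (_C b'') (suc+ a' b'')) (cong (_C b') (suc+ a'' b')))
  sharedTail : ind (a' + suc b'' + suc (a'' + suc b') ≡ᵇ suc n) * (((a' + suc b'') C a') * ((a'' + suc b') C a''))
    ≡ ind (a' + b' + a'' + b'' + 2 ≡ᵇ n) * (((a' + b'' + 1) C a') * ((a'' + b' + 1) C a''))
  sharedTail = cong₂ _*_ (cong (λ k → ind (k ≡ᵇ suc n)) (size-sharedTail a' b' a'' b''))
    (cong₂ _*_ (cong (_C a') (+suc a' b'')) (cong (_C a'') (+suc a'' b')))
  Classes : Vec Letter (suc n) → Set
  Classes W = Split [] (suc a') (suc b'') (suc a'') (suc b') W ⊎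
    (Split ((false , middle) ∷ []) (suc a') b'' (suc a'') b' W ⊎ Split ((true , middle) ∷ []) a' (suc b'') a'' (suc b') W)
  to : ∀ {W} → Classes W → Word (suc a') (suc b') (suc a'') (suc b'') W
  to {W} (inj₁ s) = subst₂ (λ x y → Word x (suc b') (suc a'') y W) (+-identityʳ (suc a')) (+-identityʳ (suc b'')) (split⇒word none s)
  to {W} (inj₂ (inj₁ s)) = subst₂ (λ x y → Word x (suc b') (suc a'') y W) (+-identityʳ (suc a')) (+-comm b'' 1) (split⇒word (shared false) s)
  to {W} (inj₂ (inj₂ s)) = subst₂ (λ x y → Word x (suc b') (suc a'') y W) (+-comm a' 1) (+-identityʳ (suc b'')) (split⇒word (shared true) s)
  from : ∀ {W} → Word (suc a') (suc b') (suc a'') (suc b'') W → Classes W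
  from w with word⇒split w
  ... | _ , none , p , q , r , s , sp , e₁ , refl , refl , e₄
    rewrite +-identityʳ p | +-identityʳ s with e₁ | e₄
  ...   | refl | refl = inj₁ sp
  from w | _ , shared false , p , q , r , s , sp , e₁ , e₂ , refl , e₄
    rewrite +-identityʳ p | +-comm s 1 with e₁ | e₂ | e₄
  ...   | refl | refl | refl = inj₂ (inj₁ sp)
  from w | _ , shared true , p , q , r , s , sp , e₁ , refl , e₃ , e₄
    rewrite +-comm p 1 | +-identityʳ s with e₁ | e₃ | e₄
  ...   | refl | refl | refl = inj₂ (inj₂ sp)

-- Saturated faces

along : Matching → ∀ {N} → Fin N → Fin N → Set
along r x y = precedes r (toℕ x) (toℕ y)

-- Under the nesting rule vertices are listed downwards, so that a list of heads increases for
-- `precedes` whichever rule holds.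
listing : Matching → ∀ N → List (Fin N)
listing nest N = tabulate opposite
listing _ N = allFin N

listing-sorted : ∀ r N → AllPairs (along r) (listing r N)
listing-sorted nest N = AllPairs.tabulate⁺-< λ {i} {j} i<j →
  subst₂ _<_ (sym (opposite-prop j)) (sym (opposite-prop i)) (∸-monoʳ-< (s≤s i<j) (toℕ<n j))
listing-sorted cross N = AllPairs.tabulate⁺-< id
listing-sorted separate N = AllPairs.tabulate⁺-< id

∈-listing : ∀ r {N} (k : Fin N) → k ∈ listing r N
∈-listing nest k = subst (_∈ tabulate opposite) (opposite-involutive k) (∈-tabulate⁺ (opposite k))
∈-listing cross k = ∈-allFin k
∈-listing separate k = ∈-allFin k

positions : Matching → (Letter → Bool) → ∀ {N} → Vec Letter N → List (Fin N)
positions r p {N} W = boolFilter (λ k → p (lookup W k)) (listing r N)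

∈-positions⁺ : ∀ r p {N} (W : Vec Letter N) {k} → T (p (lookup W k)) → k ∈ positions r p W
∈-positions⁺ r p W {k} t = ∈-boolFilter⁺ (λ k → p (lookup W k)) (∈-listing r k) t

∈-positions⁻ : ∀ r p {N} (W : Vec Letter N) {k} → k ∈ positions r p W → T (p (lookup W k))
∈-positions⁻ r p {N} W i = proj₂ (∈-boolFilter⁻ (λ k → p (lookup W k)) {xs = listing r N} i)

positions-sorted : ∀ r p {N} (W : Vec Letter N) → AllPairs (along r) (positions r p W)
positions-sorted r p {N} W = boolFilter-AllPairs (λ k → p (lookup W k)) (listing-sorted r N)

sorted⇒unique : ∀ r {N} {xs : List (Fin N)} → AllPairs (along r) xs → Unique xs
sorted⇒unique r = AllPairs.map λ { q refl → precedes-asym r q q }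

countB-lookup : ∀ (p : Letter → Bool) {N} (W : Vec Letter N) → countB (λ k → p (lookup W k)) (allFin N) ≡ countB p (toList W)
countB-lookup-suc : ∀ (p : Letter → Bool) {N} x (W : Vec Letter N) →
  countB (λ k → p (lookup (x Vec.∷ W) k)) (tabulate suc) ≡ countB p (toList W)

countB-lookup p Vec.[] = refl
countB-lookup p {suc N} (x Vec.∷ W) with p x
... | true = cong suc (countB-lookup-suc p x W)
... | false = countB-lookup-suc p x W

countB-lookup-suc p {N} x W = trans (cong (countB q) (sym (map-tabulate id Fin.suc)))
  (trans (countB-map q Fin.suc (allFin N)) (countB-lookup p W))
  where
  q : Fin (suc N) → Bool
  q k = p (lookup (x Vec.∷ W) k)

length-positions : ∀ r p {N} (W : Vec Letter N) → length (positions r p W) ≡ countB p (toList W)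
length-positions r p W = trans
  (unique-length (sorted⇒unique r (positions-sorted r p W)) (sorted⇒unique cross (positions-sorted cross p W))
    (λ i → ∈-positions⁺ cross p W (∈-positions⁻ r p W i)) (λ i → ∈-positions⁺ r p W (∈-positions⁻ cross p W i)))
  (countB-lookup p W)

AllPairs-lookup⁺ : ∀ {A : Set} {R : A → A → Set} {N} (W : Vec A N) →
  (∀ {i j} → toℕ i < toℕ j → R (lookup W i) (lookup W j)) → AllPairs R (toList W)
AllPairs-lookup⁺ Vec.[] f = []
AllPairs-lookup⁺ {R = R} (x Vec.∷ W) f = each W (λ j → f {zero} {suc j} (s≤s z≤n)) ∷ AllPairs-lookup⁺ W (λ lt → f (s≤s lt))
  where
  each : ∀ {N} (W : Vec _ N) → (∀ j → R x (lookup W j)) → All (R x) (toList W)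
  each Vec.[] g = []
  each (y Vec.∷ W) g = g zero ∷ each W (λ j → g (suc j))

AllPairs-lookup⁻ : ∀ {A : Set} {R : A → A → Set} {N} (W : Vec A N) → AllPairs R (toList W) →
  ∀ {i j} → toℕ i < toℕ j → R (lookup W i) (lookup W j)
AllPairs-lookup⁻ {R = R} (x Vec.∷ W) (a ∷ _) {zero} {suc j} _ = at W a j
  where
  at : ∀ {N} (W : Vec _ N) → All (R x) (toList W) → ∀ j → R x (lookup W j)
  at (y Vec.∷ W) (b ∷ _) zero = b
  at (y Vec.∷ W) (_ ∷ a) (suc j) = at W a j
AllPairs-lookup⁻ (x Vec.∷ W) (_ ∷ a) {suc i} {suc j} (s≤s lt) = AllPairs-lookup⁻ W a lt

valid-≤ : ∀ {N} (W : Vec Letter N) → Valid (toList W) → ∀ {i j} → T (rightish (lookup W i)) → T (leftish (lookup W j)) → toℕ j ≤ toℕ i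
valid-≤ W v x y = ≮⇒≥ λ lt → AllPairs-lookup⁻ W v lt x y

T-not⁺ : ∀ {b} → ¬ T b → T (not b)
T-not⁺ {true} n = ⊥-elim (n tt)
T-not⁺ {false} _ = tt

T-not⁻ : ∀ {b} → T (not b) → ¬ T b
T-not⁻ {false} _ ()

nonLoop : ∀ {n} → Arrow n → Bool
nonLoop a = not (tail a ≡ᵇ head a)

∈-arrows⁺ : ∀ {n} {a : Arrow n} → tail a ≢ head a → a ∈ arrows n
∈-arrows⁺ {a = x , y} ne = ∈-boolFilter⁺ nonLoop (∈-cartesianProduct⁺ (∈-allFin x) (∈-allFin y)) (T-not⁺ (ne ∘ ≡ᵇ⇒≡ (toℕ x) (toℕ y)))

∈-arrows⁻ : ∀ {n} {a : Arrow n} → a ∈ arrows n → tail a ≢ head a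
∈-arrows⁻ {n} {a} i e = T-not⁻ (proj₂ (∈-boolFilter⁻ nonLoop {xs = cartesianProduct (allFin (suc n)) (allFin (suc n))} i)) (≡⇒≡ᵇ (tail a) (head a) e)

arrows-unique : ∀ n → Unique (arrows n)
arrows-unique n = boolFilter-AllPairs nonLoop (Unique.cartesianProduct⁺ (Unique.allFin⁺ (suc n)) (Unique.allFin⁺ (suc n)))

AllPairs-∈ : {A : Set} {R : A → A → Set} {xs : List A} {x y : A} → AllPairs R xs → x ∈ xs → y ∈ xs → x ≡ y ⊎ R x y ⊎ R y x
AllPairs-∈ (a ∷ _) (here refl) (here refl) = inj₁ refl
AllPairs-∈ (a ∷ _) (here refl) (there j) = inj₂ (inj₁ (All.lookup a j))
AllPairs-∈ (a ∷ _) (there i) (here refl) = inj₂ (inj₂ (All.lookup a i))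
AllPairs-∈ (_ ∷ p) (there i) (there j) = AllPairs-∈ p i j

Covering : ∀ {n} → List (Arrow n) → Set
Covering {n} σ = ∀ (k : Fin (suc n)) → ∃ λ a → a ∈ σ × (proj₁ a ≡ k ⊎ proj₂ a ≡ k)

meets : ∀ {n} → Fin (suc n) → Arrow n → Bool
meets k a = (tail a ≡ᵇ toℕ k) ∨ (head a ≡ᵇ toℕ k)

saturated⇒covering : ∀ n (σ : List (Arrow (suc n))) → T (saturated (suc n) σ) → Covering σ
saturated⇒covering n σ t k with find (Any.any⁻ (meets k) σ (All.lookup (All.all⁺ (λ k → any (meets k) σ) (allFin (suc (suc n))) t) (∈-allFin k)))
... | a , i , e with Equivalence.to (T-∨ {tail a ≡ᵇ toℕ k}) e
...   | inj₁ e' = a , i , inj₁ (toℕ-injective (≡ᵇ⇒≡ (tail a) (toℕ k) e'))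
...   | inj₂ e' = a , i , inj₂ (toℕ-injective (≡ᵇ⇒≡ (head a) (toℕ k) e'))

covering⇒saturated : ∀ n (σ : List (Arrow (suc n))) → Covering σ → T (saturated (suc n) σ)
covering⇒saturated n σ c = All.all⁻ (λ k → any (meets k) σ) (All.tabulate {xs = allFin (suc (suc n))} λ {k} _ → Any.any⁺ (meets k) (at k (c k)))
  where
  at : ∀ k → (∃ λ a → a ∈ σ × (proj₁ a ≡ k ⊎ proj₂ a ≡ k)) → Any (T ∘ meets k) σ
  at k (a , i , inj₁ refl) = lose i (Equivalence.from T-∨ (inj₁ (≡⇒≡ᵇ (tail a) _ refl)))
  at k (a , i , inj₂ refl) = lose i (Equivalence.from (T-∨ {tail a ≡ᵇ toℕ k}) (inj₂ (≡⇒≡ᵇ (head a) _ refl)))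

-- All ordered pairs are included, which supplies both orders of `Agree`; an arrow agrees with
-- itself by `agree-tail`.
AllAgree : Matching → Matching → ∀ {n} → List (Arrow n) → Set
AllAgree r s σ = ∀ {u v} → u ∈ σ → v ∈ σ → Agree r s (tail u) (head u) (tail v) (head v)

module _ {R : RuleSet} {r s : Matching} (ok : Allowed TTHH r) (ok' : Allowed HHTT s) (R≗ : (t : PairType) → R t ≡ rules r s t) {n : ℕ} where

  clique⇒agree : ∀ {σ : List (Arrow n)} → (∀ {u} → u ∈ σ → tail u ≢ head u) → T (isClique R σ) → AllAgree r s σ
  clique⇒agree {σ} proper t {u} {v} i j with AllPairs-∈ (pairs σ proper t) i j
    where
    pairs : ∀ σ → (∀ {u} → u ∈ σ → tail u ≢ head u) → T (isClique R σ) → AllPairs (Compatible ok ok' R≗) σ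
    pairs [] _ _ = []
    pairs (a ∷ σ) proper t =
      let t₁ , t₂ = Equivalence.to T-∧ t
          edges = All.all⁺ (edge R a) σ t₁
      in All.tabulate (λ {b} k → edge⇒compatible ok ok' R≗ a b (proper (here refl)) (proper (there k)) (All.lookup edges k))
         ∷ pairs σ (proper ∘ there) t₂
  ... | inj₁ refl = agree-tail r s _ _ _
  ... | inj₂ (inj₁ (p , _)) = p
  ... | inj₂ (inj₂ (_ , p)) = p

  agree⇒clique : ∀ {σ : List (Arrow n)} → Unique σ → (∀ {u} → u ∈ σ → tail u ≢ head u) → AllAgree r s σ → T (isClique R σ)
  agree⇒clique [] proper agree = tt
  agree⇒clique {a ∷ σ} (a∉ ∷ u) proper agree = Equivalence.from T-∧
    ( All.all⁻ (edge R a) (All.tabulate {xs = σ} λ {b} k → compatible⇒edge ok ok' R≗ a b (proper (here refl)) (proper (there k))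
        (All.lookup a∉ k) (agree (here refl) (there k) , agree (there k) (here refl)))
    , agree⇒clique u (proper ∘ there) (λ i j → agree (there i) (there j)))

-- Encoding faces by words and walks

fwdTail⁻ : ∀ x → T (fwdTail x) → proj₁ x ≡ true × T (leftish x)
fwdTail⁻ (true , _) t = refl , t

fwdHead⁻ : ∀ x → T (fwdHead x) → proj₁ x ≡ false × T (rightish x)
fwdHead⁻ (false , _) t = refl , t

bwdTail⁻ : ∀ x → T (bwdTail x) → proj₁ x ≡ true × T (rightish x)
bwdTail⁻ (true , _) t = refl , t

bwdHead⁻ : ∀ x → T (bwdHead x) → proj₁ x ≡ false × T (leftish x)
bwdHead⁻ (false , _) t = refl , t

some-role : ∀ x → (T (fwdTail x) ⊎ T (bwdTail x)) ⊎ (T (fwdHead x) ⊎ T (bwdHead x))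
some-role (true , left) = inj₁ (inj₁ tt)
some-role (true , middle) = inj₁ (inj₁ tt)
some-role (true , right) = inj₁ (inj₂ tt)
some-role (false , left) = inj₂ (inj₂ tt)
some-role (false , middle) = inj₂ (inj₂ tt)
some-role (false , right) = inj₂ (inj₁ tt)

side : Bool → Bool → Side
side true true = middle
side true false = left
-- Also the default for a vertex without any role, a case that `roles-letter` excludes.
side false _ = right

letter : (ft fh bt bh : Bool) → Letter
letter ft fh bt bh = ft ∨ bt , side (ft ∨ bh) (fh ∨ bt)

letter-roles : ∀ x → letter (fwdTail x) (fwdHead x) (bwdTail x) (bwdHead x) ≡ x
letter-roles (true , left) = refl
letter-roles (true , middle) = refl
letter-roles (true , right) = refl
letter-roles (false , left) = refl
letter-roles (false , middle) = refl
letter-roles (false , right) = refl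

-- The hypothesis says that the vertex is either a tail or a head but not both. Six combinations of
-- roles satisfy it, one for each letter.
roles-letter : ∀ ft fh bt bh → (ft ∨ bt) xor (fh ∨ bh) ≡ true → let x = letter ft fh bt bh in
  fwdTail x ≡ ft × fwdHead x ≡ fh × bwdTail x ≡ bt × bwdHead x ≡ bh
roles-letter true false true false _ = refl , refl , refl , refl
roles-letter true false false false _ = refl , refl , refl , refl
roles-letter false false true false _ = refl , refl , refl , refl
roles-letter false true false true _ = refl , refl , refl , refl
roles-letter false true false false _ = refl , refl , refl , refl
roles-letter false false false true _ = refl , refl , refl , refl

exclusive : ∀ {P Q P' Q' : Set} (p : Dec P) (q : Dec Q) (p' : Dec P') (q' : Dec Q') → (P ⊎ Q) ⊎ (P' ⊎ Q') →
  (P ⊎ Q → P' ⊎ Q' → ⊥) → (does p ∨ does q) xor (does p' ∨ does q') ≡ true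
exclusive (yes p) _ (yes p') _ _ ex = ⊥-elim (ex (inj₁ p) (inj₁ p'))
exclusive (yes p) _ (no _) (yes q') _ ex = ⊥-elim (ex (inj₁ p) (inj₂ q'))
exclusive (yes p) _ (no _) (no _) _ ex = refl
exclusive (no _) (yes q) (yes p') _ _ ex = ⊥-elim (ex (inj₂ q) (inj₁ p'))
exclusive (no _) (yes q) (no _) (yes q') _ ex = ⊥-elim (ex (inj₂ q) (inj₂ q'))
exclusive (no _) (yes q) (no _) (no _) _ ex = refl
exclusive (no _) (no _) (yes _) _ _ ex = refl
exclusive (no _) (no _) (no _) (yes _) _ ex = refl
exclusive (no ¬p) (no ¬q) (no ¬p') (no ¬q') some ex = ⊥-elim ([ [ ¬p , ¬q ]′ , [ ¬p' , ¬q' ]′ ]′ some)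

leftish-roles : ∀ x → T (leftish x) → T (fwdTail x) ⊎ T (bwdHead x)
leftish-roles (true , _) t = inj₁ t
leftish-roles (false , _) t = inj₂ t

rightish-roles : ∀ x → T (rightish x) → T (bwdTail x) ⊎ T (fwdHead x)
rightish-roles (true , _) t = inj₁ t
rightish-roles (false , _) t = inj₂ t

≢⇒<⊎> : ∀ {m n} → m ≢ n → m < n ⊎ n < m
≢⇒<⊎> {m} {n} ne with <-cmp m n
... | tri< lt _ _ = inj₁ lt
... | tri≈ _ e _ = ⊥-elim (ne e)
... | tri> _ _ gt = inj₂ gt

module Coding (r s : Matching) (n : ℕ) where

  private
    N = suc n

  -- Index 1 is the forward and index 2 the backward direction. Tails are always listed upwards; the
  -- heads follow the free rule of their direction.
  T₁ H₁ T₂ H₂ : Vec Letter N → List (Fin N)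
  T₁ = positions cross fwdTail
  H₁ = positions r fwdHead
  T₂ = positions cross bwdTail
  H₂ = positions s bwdHead

  Code : Set
  Code = Vec Letter N × Maybe (List Step) × Maybe (List Step)

  forwards backwards codeArrows : Code → List (Arrow n)
  forwards (W , m , _) = trail (T₁ W) (H₁ W) m
  backwards (W , _ , m) = trail (T₂ W) (H₂ W) m
  codeArrows c = forwards c ++ backwards c

  Fitting : Code → Set
  Fitting (W , m , m') = Valid (toList W) × TrailFits (T₁ W) (H₁ W) m × TrailFits (T₂ W) (H₂ W) m'

  -- From codes to faces

  module Decoding {c : Code} (fit : Fitting c) where

    private
      W = proj₁ c
      path₁ = proj₁ (proj₂ c)
      path₂ = proj₂ (proj₂ c)
      valid = proj₁ fit
      fit₁ = proj₁ (proj₂ fit)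
      fit₂ = proj₂ (proj₂ fit)

    forwards-roles : ∀ {u} → u ∈ forwards c → T (fwdTail (lookup W (proj₁ u))) × T (fwdHead (lookup W (proj₂ u)))
    forwards-roles i = let x , y = trail-⊆ path₁ fit₁ i in ∈-positions⁻ cross fwdTail W x , ∈-positions⁻ r fwdHead W y

    backwards-roles : ∀ {u} → u ∈ backwards c → T (bwdTail (lookup W (proj₁ u))) × T (bwdHead (lookup W (proj₂ u)))
    backwards-roles i = let x , y = trail-⊆ path₂ fit₂ i in ∈-positions⁻ cross bwdTail W x , ∈-positions⁻ s bwdHead W y

    role-≢ : ∀ {i j : Fin N} → proj₁ (lookup W i) ≡ true → proj₁ (lookup W j) ≡ false → toℕ i ≢ toℕ j
    role-≢ e e' ij with toℕ-injective ij
    ... | refl with trans (sym e) e'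
    ...   | ()

    -- A forward tail is leftish and a forward head rightish, so validity gives `≤`; equality would
    -- make one letter both a tail and a head.
    fwdTail<fwdHead : ∀ {i j} → T (fwdTail (lookup W i)) → T (fwdHead (lookup W j)) → toℕ i < toℕ j
    fwdTail<fwdHead t h = let a , b = fwdTail⁻ _ t ; a' , b' = fwdHead⁻ _ h in ≤∧≢⇒< (valid-≤ W valid b' b) (role-≢ a a')

    bwdHead<bwdTail : ∀ {i j} → T (bwdHead (lookup W i)) → T (bwdTail (lookup W j)) → toℕ i < toℕ j
    bwdHead<bwdTail h t = let a , b = bwdHead⁻ _ h ; a' , b' = bwdTail⁻ _ t in ≤∧≢⇒< (valid-≤ W valid b' b) (≢-sym (role-≢ a' a))

    forwards-forward : ∀ {u} → u ∈ forwards c → tail u < head u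
    forwards-forward i = let t , h = forwards-roles i in fwdTail<fwdHead t h

    backwards-backward : ∀ {u} → u ∈ backwards c → head u < tail u
    backwards-backward i = let t , h = backwards-roles i in bwdHead<bwdTail h t

    forward∈ : ∀ {u} → u ∈ codeArrows c → tail u < head u → u ∈ forwards c
    forward∈ i lt with ∈-++⁻ (forwards c) i
    ... | inj₁ j = j
    ... | inj₂ j = ⊥-elim (<-asym lt (backwards-backward j))

    backward∈ : ∀ {u} → u ∈ codeArrows c → head u < tail u → u ∈ backwards c
    backward∈ i lt with ∈-++⁻ (forwards c) i
    ... | inj₁ j = ⊥-elim (<-asym lt (forwards-forward j))
    ... | inj₂ j = j

    codeArrows-proper : ∀ {u} → u ∈ codeArrows c → tail u ≢ head u
    codeArrows-proper i = [ (λ j → <⇒≢ (forwards-forward j)) , (λ j → ≢-sym (<⇒≢ (backwards-backward j))) ]′ (∈-++⁻ (forwards c) i)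

    forwards-unique : Unique (forwards c)
    forwards-unique = trail-unique {_<₁_ = along cross} {_<₂_ = along r} <-asym (precedes-asym r)
      (positions-sorted cross fwdTail W) (positions-sorted r fwdHead W) path₁ fit₁

    backwards-unique : Unique (backwards c)
    backwards-unique = trail-unique {_<₁_ = along cross} {_<₂_ = along s} <-asym (precedes-asym s)
      (positions-sorted cross bwdTail W) (positions-sorted s bwdHead W) path₂ fit₂

    -- The walks contribute only the chain conditions within each direction; every other inequality
    -- comes from the word.
    codeArrows-agree : AllAgree r s (codeArrows c)
    codeArrows-agree {u} {v} i j = ff , bb , fb
      where
      ff : tail u < head u → tail v < head v → tail u < head v × ¬ (tail u < tail v × precedes r (head v) (head u))
      ff p q = fwdTail<fwdHead (proj₁ (forwards-roles (forward∈ i p))) (proj₂ (forwards-roles (forward∈ j q))) ,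
        trail-chain {_<₁_ = along cross} {_<₂_ = along r} <-asym (precedes-asym r)
          (positions-sorted cross fwdTail W) (positions-sorted r fwdHead W) path₁ fit₁ (forward∈ i p) (forward∈ j q)
      bb : head u < tail u → head v < tail v → head u < tail v × ¬ (tail u < tail v × precedes s (head v) (head u))
      bb p q = bwdHead<bwdTail (proj₂ (backwards-roles (backward∈ i p))) (proj₁ (backwards-roles (backward∈ j q))) ,
        trail-chain {_<₁_ = along cross} {_<₂_ = along s} <-asym (precedes-asym s)
          (positions-sorted cross bwdTail W) (positions-sorted s bwdHead W) path₂ fit₂ (backward∈ i p) (backward∈ j q)
      fb : tail u < head u → head v < tail v → tail u ≤ tail v × head v ≤ head u × tail u ≢ head v × head u ≢ tail v
      fb p q =
        let t , h = forwards-roles (forward∈ i p)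
            t' , h' = backwards-roles (backward∈ j q)
            a , b = fwdTail⁻ _ t
            c , d = fwdHead⁻ _ h
            a' , b' = bwdTail⁻ _ t'
            c' , d' = bwdHead⁻ _ h'
        in valid-≤ W valid b' b , valid-≤ W valid d d' , role-≢ a c' , ≢-sym (role-≢ a' c)

    fwdTail-arrow : ∀ k → T (fwdTail (lookup W k)) → ∃ λ h → (k , h) ∈ forwards c
    fwdTail-arrow k t = trail-row path₁ fit₁ (∈-positions⁺ cross fwdTail W t)

    fwdHead-arrow : ∀ k → T (fwdHead (lookup W k)) → ∃ λ t → (t , k) ∈ forwards c
    fwdHead-arrow k t = trail-column path₁ fit₁ (∈-positions⁺ r fwdHead W t)

    bwdTail-arrow : ∀ k → T (bwdTail (lookup W k)) → ∃ λ h → (k , h) ∈ backwards c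
    bwdTail-arrow k t = trail-row path₂ fit₂ (∈-positions⁺ cross bwdTail W t)

    bwdHead-arrow : ∀ k → T (bwdHead (lookup W k)) → ∃ λ t → (t , k) ∈ backwards c
    bwdHead-arrow k t = trail-column path₂ fit₂ (∈-positions⁺ s bwdHead W t)

    codeArrows-covering : Covering (codeArrows c)
    codeArrows-covering k with some-role (lookup W k)
    ... | inj₁ (inj₁ t) = let h , i = fwdTail-arrow k t in _ , ∈-++⁺ˡ i , inj₁ refl
    ... | inj₁ (inj₂ t) = let h , i = bwdTail-arrow k t in _ , ∈-++⁺ʳ (forwards c) i , inj₁ refl
    ... | inj₂ (inj₁ t) = let h , i = fwdHead-arrow k t in _ , ∈-++⁺ˡ i , inj₂ refl
    ... | inj₂ (inj₂ t) = let h , i = bwdHead-arrow k t in _ , ∈-++⁺ʳ (forwards c) i , inj₂ refl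

  -- Equality as sets of arrows, with `σ` in the fixed order of `arrows n`.
  Represents : Code → List (Arrow n) → Set
  Represents c σ = σ ∈ sublists (arrows n) × (∀ {a} → a ∈ σ → a ∈ codeArrows c) × (∀ {a} → a ∈ codeArrows c → a ∈ σ)

  represents-functional : ∀ {c σ τ} → Represents c σ → Represents c τ → σ ≡ τ
  represents-functional (i , f , g) (j , f' , g') = sublists-ext (arrows-unique n) i j (g' ∘ f) (g ∘ f')

  _∈?_ : (a : Arrow n) (σ : List (Arrow n)) → Dec (a ∈ σ)
  _∈?_ = DecMembership._∈?_ (≡-dec Fin._≟_ Fin._≟_)

  code-represents : ∀ c → Fitting c → ∃ λ σ → Represents c σ
  code-represents c fit = boolFilter p (arrows n) , boolFilter∈sublists p (arrows n) ,
    (λ {a} i → does-sound (a ∈? codeArrows c) (proj₂ (∈-boolFilter⁻ p {xs = arrows n} i))) ,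
    (λ {a} i → ∈-boolFilter⁺ p (∈-arrows⁺ (Decoding.codeArrows-proper fit i)) (does-complete (a ∈? codeArrows c) i))
    where
    p : Arrow n → Bool
    p a = does (a ∈? codeArrows c)

  forward-count : ∀ {c σ} → Fitting c → Represents c σ → countB forward? σ ≡ trailLength (proj₁ (proj₂ c))
  forward-count {c} {σ} fit (i , f , g) = trans
    (unique-length (boolFilter-AllPairs forward? (sublists-AllPairs (arrows-unique n) i)) forwards-unique
      (λ j → let k , t = ∈-boolFilter⁻ forward? {xs = σ} j in forward∈ (f k) (<ᵇ⇒< _ _ t))
      (λ j → ∈-boolFilter⁺ forward? (g (∈-++⁺ˡ j)) (<⇒<ᵇ (forwards-forward j))))
    (length-trail (proj₁ (proj₂ c)) (proj₁ (proj₂ fit)))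
    where open Decoding fit

  backward-count : ∀ {c σ} → Fitting c → Represents c σ → countB backward? σ ≡ trailLength (proj₂ (proj₂ c))
  backward-count {c} {σ} fit (i , f , g) = trans
    (unique-length (boolFilter-AllPairs backward? (sublists-AllPairs (arrows-unique n) i)) backwards-unique
      (λ j → let k , t = ∈-boolFilter⁻ backward? {xs = σ} j in backward∈ (f k) (<ᵇ⇒< _ _ t))
      (λ j → ∈-boolFilter⁺ backward? (g (∈-++⁺ʳ (forwards c) j)) (<⇒<ᵇ (backwards-backward j))))
    (length-trail (proj₂ (proj₂ c)) (proj₂ (proj₂ fit)))
    where open Decoding fit

  FwdTail FwdHead BwdTail BwdHead : List (Arrow n) → Fin N → Set
  FwdTail σ k = ∃ λ h → (k , h) ∈ σ × toℕ k < toℕ h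
  FwdHead σ k = ∃ λ t → (t , k) ∈ σ × toℕ t < toℕ k
  BwdTail σ k = ∃ λ h → (k , h) ∈ σ × toℕ h < toℕ k
  BwdHead σ k = ∃ λ t → (t , k) ∈ σ × toℕ k < toℕ t

  -- The four predicates on the right mention the face alone, so a face determines its word.
  Spells : Vec Letter N → List (Arrow n) → Set
  Spells W σ = ∀ k → let x = lookup W k in
    ((T (fwdTail x) → FwdTail σ k) × (FwdTail σ k → T (fwdTail x))) ×
    ((T (fwdHead x) → FwdHead σ k) × (FwdHead σ k → T (fwdHead x))) ×
    ((T (bwdTail x) → BwdTail σ k) × (BwdTail σ k → T (bwdTail x))) ×
    ((T (bwdHead x) → BwdHead σ k) × (BwdHead σ k → T (bwdHead x)))

  T-ext : ∀ {a b} → (T a → T b) → (T b → T a) → a ≡ b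
  T-ext {true} {true} f g = refl
  T-ext {true} {false} f g = ⊥-elim (f tt)
  T-ext {false} {true} f g = ⊥-elim (g tt)
  T-ext {false} {false} f g = refl

  spells-injective : ∀ {V W σ} → Spells V σ → Spells W σ → V ≡ W
  spells-injective {V} {W} sp sp' = trans (sym (tabulate∘lookup V)) (trans (tabulate-cong same) (tabulate∘lookup W))
    where
    same : ∀ k → lookup V k ≡ lookup W k
    same k with sp k | sp' k
    ... | (a , a⁻) , (b , b⁻) , (c , c⁻) , (d , d⁻) | (a' , a'⁻) , (b' , b'⁻) , (c' , c'⁻) , (d' , d'⁻) =
      trans (sym (letter-roles (lookup V k))) (trans
        (trans (cong₂ (λ x y → letter x y _ _) (T-ext (a'⁻ ∘ a) (a⁻ ∘ a')) (T-ext (b'⁻ ∘ b) (b⁻ ∘ b')))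
               (cong₂ (letter _ _) (T-ext (c'⁻ ∘ c) (c⁻ ∘ c')) (T-ext (d'⁻ ∘ d) (d⁻ ∘ d'))))
        (letter-roles (lookup W k)))

  represents-spells : ∀ {c σ} → Fitting c → Represents c σ → Spells (proj₁ c) σ
  represents-spells {c} fit (_ , f , g) k =
    ((λ t → let h , i = fwdTail-arrow k t in h , g (∈-++⁺ˡ i) , forwards-forward i) ,
     (λ (h , i , lt) → proj₁ (forwards-roles (forward∈ (f i) lt)))) ,
    ((λ t → let h , i = fwdHead-arrow k t in h , g (∈-++⁺ˡ i) , forwards-forward i) ,
     (λ (h , i , lt) → proj₂ (forwards-roles (forward∈ (f i) lt)))) ,
    ((λ t → let h , i = bwdTail-arrow k t in h , g (∈-++⁺ʳ (forwards c) i) , backwards-backward i) ,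
     (λ (h , i , lt) → proj₁ (backwards-roles (backward∈ (f i) lt)))) ,
    ((λ t → let h , i = bwdHead-arrow k t in h , g (∈-++⁺ʳ (forwards c) i) , backwards-backward i) ,
     (λ (h , i , lt) → proj₂ (backwards-roles (backward∈ (f i) lt))))
    where open Decoding fit

  -- The face determines the word, and the word determines the grids. The arrows of each direction
  -- are then the cells of both walks in the same grid, so the walks coincide.
  represents-injective : ∀ {c c' σ} → Fitting c → Fitting c' → Represents c σ → Represents c' σ → c ≡ c'
  represents-injective {W , m₁ , m₂} {W' , m₁' , m₂'} {σ} fit fit' ρ@(_ , f , g) ρ'@(_ , f' , g')
    with spells-injective {W} {W'} {σ} (represents-spells fit ρ) (represents-spells fit' ρ')
  ... | refl = cong₂ (λ x y → W , x , y)
    (trail-injective {_<₁_ = along cross} {_<₂_ = along r} <-asym (precedes-asym r)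
      (positions-sorted cross fwdTail W) (positions-sorted r fwdHead W) m₁ m₁' (proj₁ (proj₂ fit)) (proj₁ (proj₂ fit'))
      (λ i → D'.forward∈ (f' (g (∈-++⁺ˡ i))) (D.forwards-forward i))
      (λ i → D.forward∈ (f (g' (∈-++⁺ˡ i))) (D'.forwards-forward i)))
    (trail-injective {_<₁_ = along cross} {_<₂_ = along s} <-asym (precedes-asym s)
      (positions-sorted cross bwdTail W) (positions-sorted s bwdHead W) m₂ m₂' (proj₂ (proj₂ fit)) (proj₂ (proj₂ fit'))
      (λ i → D'.backward∈ (f' (g (∈-++⁺ʳ (forwards (W , m₁ , m₂)) i))) (D.backwards-backward i))
      (λ i → D.backward∈ (f (g' (∈-++⁺ʳ (forwards (W , m₁' , m₂')) i))) (D'.backwards-backward i)))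
    where
    module D = Decoding fit
    module D' = Decoding fit'

  -- From faces to codes

  module Encoding {σ : List (Arrow n)} (σ∈ : σ ∈ sublists (arrows n)) (agree : AllAgree r s σ) (covering : Covering σ) where

    proper : ∀ {u} → u ∈ σ → tail u ≢ head u
    proper i = ∈-arrows⁻ (sublists-⊆ σ∈ i)

    abstract
      fwdTail? : ∀ k → Dec (FwdTail σ k)
      fwdTail? k = Fin.any? λ h → ((k , h) ∈? σ) ×-dec (toℕ k <? toℕ h)

      fwdHead? : ∀ k → Dec (FwdHead σ k)
      fwdHead? k = Fin.any? λ t → ((t , k) ∈? σ) ×-dec (toℕ t <? toℕ k)

      bwdTail? : ∀ k → Dec (BwdTail σ k)
      bwdTail? k = Fin.any? λ h → ((k , h) ∈? σ) ×-dec (toℕ h <? toℕ k)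

      bwdHead? : ∀ k → Dec (BwdHead σ k)
      bwdHead? k = Fin.any? λ t → ((t , k) ∈? σ) ×-dec (toℕ k <? toℕ t)

    fwdTail≤bwdTail : ∀ {i j} → FwdTail σ i → BwdTail σ j → toℕ i ≤ toℕ j
    fwdTail≤bwdTail (_ , a , p) (_ , b , q) = proj₁ (proj₂ (proj₂ (agree a b)) p q)

    bwdHead≤fwdHead : ∀ {i j} → BwdHead σ i → FwdHead σ j → toℕ i ≤ toℕ j
    bwdHead≤fwdHead (_ , b , q) (_ , a , p) = proj₁ (proj₂ (proj₂ (proj₂ (agree a b)) p q))

    fwdTail<fwdHead : ∀ {i j} → FwdTail σ i → FwdHead σ j → toℕ i < toℕ j
    fwdTail<fwdHead (_ , a , p) (_ , b , q) = proj₁ (proj₁ (agree a b) p q)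

    bwdHead<bwdTail : ∀ {i j} → BwdHead σ i → BwdTail σ j → toℕ i < toℕ j
    bwdHead<bwdTail (_ , a , p) (_ , b , q) = proj₁ (proj₁ (proj₂ (agree a b)) p q)

    fwdTail≢bwdHead : ∀ {k} → FwdTail σ k → ¬ BwdHead σ k
    fwdTail≢bwdHead (_ , a , p) (_ , b , q) = proj₁ (proj₂ (proj₂ (proj₂ (proj₂ (agree a b)) p q))) refl

    bwdTail≢fwdHead : ∀ {k} → BwdTail σ k → ¬ FwdHead σ k
    bwdTail≢fwdHead (_ , b , q) (_ , a , p) = proj₂ (proj₂ (proj₂ (proj₂ (proj₂ (agree a b)) p q))) refl

    letterAt : Fin N → Letter
    letterAt k = letter (does (fwdTail? k)) (does (fwdHead? k)) (does (bwdTail? k)) (does (bwdHead? k))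

    word : Vec Letter N
    word = Vec.tabulate letterAt

    some-arrow : ∀ k → (FwdTail σ k ⊎ BwdTail σ k) ⊎ (FwdHead σ k ⊎ BwdHead σ k)
    some-arrow k with covering k
    ... | (x , y) , i , e with <-cmp (toℕ x) (toℕ y) | e
    ...   | tri≈ _ eq _ | _ = ⊥-elim (proper i eq)
    ...   | tri< lt _ _ | inj₁ refl = inj₁ (inj₁ (_ , i , lt))
    ...   | tri< lt _ _ | inj₂ refl = inj₂ (inj₁ (_ , i , lt))
    ...   | tri> _ _ gt | inj₁ refl = inj₁ (inj₂ (_ , i , gt))
    ...   | tri> _ _ gt | inj₂ refl = inj₂ (inj₂ (_ , i , gt))

    -- Covering gives each vertex at least one role. A tail and a head role cannot meet at a vertex:
    -- within one direction by the strict inequality between tails and heads, across directions by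
    -- the disequalities in `Agree`.
    word-spells : Spells word σ
    word-spells k =
      let a , b , c , d = roles-letter (does (fwdTail? k)) (does (fwdHead? k)) (does (bwdTail? k)) (does (bwdHead? k))
            (exclusive (fwdTail? k) (bwdTail? k) (fwdHead? k) (bwdHead? k) (some-arrow k)
              (λ { (inj₁ x) (inj₁ y) → <-irrefl refl (fwdTail<fwdHead x y)
                 ; (inj₁ x) (inj₂ y) → fwdTail≢bwdHead x y
                 ; (inj₂ x) (inj₁ y) → bwdTail≢fwdHead x y
                 ; (inj₂ x) (inj₂ y) → <-irrefl refl (bwdHead<bwdTail y x) }))
          at = lookup∘tabulate letterAt k
      in via (fwdTail? k) (trans (cong fwdTail at) a) , via (fwdHead? k) (trans (cong fwdHead at) b) ,
         via (bwdTail? k) (trans (cong bwdTail at) c) , via (bwdHead? k) (trans (cong bwdHead at) d)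
      where
      via : ∀ {P : Set} {b} (P? : Dec P) → b ≡ does P? → (T b → P) × (P → T b)
      via P? refl = does-sound P? , does-complete P?

    leftish⁻ : ∀ k → T (leftish (lookup word k)) → FwdTail σ k ⊎ BwdHead σ k
    leftish⁻ k t with leftish-roles (lookup word k) t
    ... | inj₁ ft = inj₁ (proj₁ (proj₁ (word-spells k)) ft)
    ... | inj₂ bh = inj₂ (proj₁ (proj₂ (proj₂ (proj₂ (word-spells k)))) bh)

    rightish⁻ : ∀ k → T (rightish (lookup word k)) → BwdTail σ k ⊎ FwdHead σ k
    rightish⁻ k t with rightish-roles (lookup word k) t
    ... | inj₁ bt = inj₁ (proj₁ (proj₁ (proj₂ (proj₂ (word-spells k)))) bt)
    ... | inj₂ fh = inj₂ (proj₁ (proj₁ (proj₂ (word-spells k))) fh)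

    word-valid : Valid (toList word)
    word-valid = AllPairs-lookup⁺ word λ {i} {j} lt x y → <⇒≱ lt (cross-≤ (leftish⁻ j y) (rightish⁻ i x))
      where
      cross-≤ : ∀ {i j} → FwdTail σ j ⊎ BwdHead σ j → BwdTail σ i ⊎ FwdHead σ i → toℕ j ≤ toℕ i
      cross-≤ (inj₁ x) (inj₁ y) = fwdTail≤bwdTail x y
      cross-≤ (inj₁ x) (inj₂ y) = <⇒≤ (fwdTail<fwdHead x y)
      cross-≤ (inj₂ x) (inj₁ y) = <⇒≤ (bwdHead<bwdTail x y)
      cross-≤ (inj₂ x) (inj₂ y) = bwdHead≤fwdHead x y

    fwdTail⇔ : ∀ {k} → (k ∈ T₁ word → FwdTail σ k) × (FwdTail σ k → k ∈ T₁ word)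
    fwdTail⇔ {k} = let (f , g) , _ = word-spells k in
      f ∘ ∈-positions⁻ cross fwdTail word , ∈-positions⁺ cross fwdTail word ∘ g

    fwdHead⇔ : ∀ {k} → (k ∈ H₁ word → FwdHead σ k) × (FwdHead σ k → k ∈ H₁ word)
    fwdHead⇔ {k} = let _ , (f , g) , _ = word-spells k in
      f ∘ ∈-positions⁻ r fwdHead word , ∈-positions⁺ r fwdHead word ∘ g

    bwdTail⇔ : ∀ {k} → (k ∈ T₂ word → BwdTail σ k) × (BwdTail σ k → k ∈ T₂ word)
    bwdTail⇔ {k} = let _ , _ , (f , g) , _ = word-spells k in
      f ∘ ∈-positions⁻ cross bwdTail word , ∈-positions⁺ cross bwdTail word ∘ g

    bwdHead⇔ : ∀ {k} → (k ∈ H₂ word → BwdHead σ k) × (BwdHead σ k → k ∈ H₂ word)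
    bwdHead⇔ {k} = let _ , _ , _ , (f , g) = word-spells k in
      f ∘ ∈-positions⁻ s bwdHead word , ∈-positions⁺ s bwdHead word ∘ g

    -- A vertex is listed in `T₁` or `H₁` because some forward arrow of the face uses it, and the
    -- other end of that arrow is listed as well. So rows and columns are covered, and agreement
    -- gives the chain condition.
    forward-trail : ∃ λ m → TrailFits (T₁ word) (H₁ word) m ×
      (∀ {x y} → (x , y) ∈ trail (T₁ word) (H₁ word) m → (x , y) ∈ σ × toℕ x < toℕ y) ×
      (∀ {x y} → x ∈ T₁ word → y ∈ H₁ word → (x , y) ∈ σ × toℕ x < toℕ y → (x , y) ∈ trail (T₁ word) (H₁ word) m)
    forward-trail = chain-trail {_<₁_ = along cross} {_<₂_ = along r} <-asym (precedes-asym r)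
      (positions-sorted cross fwdTail word) (positions-sorted r fwdHead word)
      (λ x y → (x , y) ∈ σ × toℕ x < toℕ y) (λ x y → ((x , y) ∈? σ) ×-dec (toℕ x <? toℕ y))
      (λ (i , p) (j , q) → proj₂ (proj₁ (agree i j) p q))
      (λ {x} i → let y , j , lt = proj₁ fwdTail⇔ i in y , proj₂ fwdHead⇔ (x , j , lt) , j , lt)
      (λ {y} i → let x , j , lt = proj₁ fwdHead⇔ i in x , proj₂ fwdTail⇔ (y , j , lt) , j , lt)

    backward-trail : ∃ λ m → TrailFits (T₂ word) (H₂ word) m ×
      (∀ {x y} → (x , y) ∈ trail (T₂ word) (H₂ word) m → (x , y) ∈ σ × toℕ y < toℕ x) ×
      (∀ {x y} → x ∈ T₂ word → y ∈ H₂ word → (x , y) ∈ σ × toℕ y < toℕ x → (x , y) ∈ trail (T₂ word) (H₂ word) m)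
    backward-trail = chain-trail {_<₁_ = along cross} {_<₂_ = along s} <-asym (precedes-asym s)
      (positions-sorted cross bwdTail word) (positions-sorted s bwdHead word)
      (λ x y → (x , y) ∈ σ × toℕ y < toℕ x) (λ x y → ((x , y) ∈? σ) ×-dec (toℕ y <? toℕ x))
      (λ (i , p) (j , q) → proj₂ (proj₁ (proj₂ (agree i j)) p q))
      (λ {x} i → let y , j , lt = proj₁ bwdTail⇔ i in y , proj₂ bwdHead⇔ (x , j , lt) , j , lt)
      (λ {y} i → let x , j , lt = proj₁ bwdHead⇔ i in x , proj₂ bwdTail⇔ (y , j , lt) , j , lt)

    face-represented : ∃ λ c → Fitting c × Represents c σ
    face-represented with forward-trail | backward-trail
    ... | m , fit , f , g | m' , fit' , f' , g' = c , (word-valid , fit , fit') , σ∈ , include ,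
      (λ i → [ (λ j → proj₁ (f j)) , (λ j → proj₁ (f' j)) ]′ (∈-++⁻ (forwards c) i))
      where
      c : Code
      c = word , m , m'
      include : ∀ {a} → a ∈ σ → a ∈ codeArrows c
      include {x , y} i with ≢⇒<⊎> (proper i)
      ... | inj₁ lt = ∈-++⁺ˡ (g (proj₂ fwdTail⇔ (y , i , lt)) (proj₂ fwdHead⇔ (x , i , lt)) (i , lt))
      ... | inj₂ gt = ∈-++⁺ʳ (forwards c) (g' (proj₂ bwdTail⇔ (y , i , gt)) (proj₂ bwdHead⇔ (x , i , gt)) (i , gt))

-- Enumeration of lattice paths

Path : ℕ → ℕ → ℕ → List Step → Set
Path a b k w = length w ≡ k × endpoint w ≡ (a , b)

extensions : List Step → List (List Step)
extensions w = (up ∷ w) ∷ (right ∷ w) ∷ (diag ∷ w) ∷ []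

∈-concatMap-extensions⁻ : ∀ {w} ws → w ∈ concatMap extensions ws → ∃ λ x → ∃ λ v → w ≡ x ∷ v × v ∈ ws
∈-concatMap-extensions⁻ (v ∷ ws) (here e) = up , v , e , here refl
∈-concatMap-extensions⁻ (v ∷ ws) (there (here e)) = right , v , e , here refl
∈-concatMap-extensions⁻ (v ∷ ws) (there (there (here e))) = diag , v , e , here refl
∈-concatMap-extensions⁻ (v ∷ ws) (there (there (there i))) =
  let x , v' , e , j = ∈-concatMap-extensions⁻ ws i in x , v' , e , there j

∈-concatMap-extensions⁺ : ∀ x {v ws} → v ∈ ws → (x ∷ v) ∈ concatMap extensions ws
∈-concatMap-extensions⁺ up (here refl) = here refl
∈-concatMap-extensions⁺ right (here refl) = there (here refl)
∈-concatMap-extensions⁺ diag (here refl) = there (there (here refl))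
∈-concatMap-extensions⁺ x (there i) = there (there (there (∈-concatMap-extensions⁺ x i)))

concatMap-extensions-unique : ∀ {ws} → Unique ws → Unique (concatMap extensions ws)
concatMap-extensions-unique [] = []
concatMap-extensions-unique {w ∷ ws} (w∉ ∷ u) =
  ((λ ()) ∷ (λ ()) ∷ All.tabulate fresh) ∷ ((λ ()) ∷ All.tabulate fresh) ∷ All.tabulate fresh ∷ concatMap-extensions-unique u
  where
  fresh : ∀ {x v} → v ∈ concatMap extensions ws → x ∷ w ≢ v
  fresh i refl with ∈-concatMap-extensions⁻ ws i
  ... | _ , _ , refl , j = All.lookup w∉ j refl

∈-stepWords⁺ : ∀ w → w ∈ stepWords (length w)
∈-stepWords⁺ [] = here refl
∈-stepWords⁺ (x ∷ w) = ∈-concatMap-extensions⁺ x (∈-stepWords⁺ w)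

∈-stepWords⁻ : ∀ k {w} → w ∈ stepWords k → length w ≡ k
∈-stepWords⁻ zero (here refl) = refl
∈-stepWords⁻ (suc k) i with ∈-concatMap-extensions⁻ (stepWords k) i
... | _ , _ , refl , j = cong suc (∈-stepWords⁻ k j)

stepWords-unique : ∀ k → Unique (stepWords k)
stepWords-unique zero = [] ∷ []
stepWords-unique (suc k) = concatMap-extensions-unique (stepWords-unique k)

count-path : ∀ a b k → Counts (Path a b k) (delannoy a b k)
count-path a b k = counts-⇔
  (λ {w} (i , t) → let e , e' = Equivalence.to T-∧ t in
    ∈-stepWords⁻ k i , cong₂ _,_ (≡ᵇ⇒≡ (proj₁ (endpoint w)) a e) (≡ᵇ⇒≡ (proj₂ (endpoint w)) b e'))
  (λ { {w} (refl , e) → ∈-stepWords⁺ w ,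
    Equivalence.from T-∧ (≡⇒≡ᵇ (proj₁ (endpoint w)) a (cong proj₁ e) , ≡⇒≡ᵇ (proj₂ (endpoint w)) b (cong proj₂ e)) })
  (counts-boolFilter (λ w → (proj₁ (endpoint w) ≡ᵇ a) ∧ (proj₂ (endpoint w) ≡ᵇ b)) (stepWords k) (stepWords-unique k))

-- Coefficients of the right-hand side

sumTo-cong : ∀ n {g h : ℕ → ℕ} → (∀ i → g i ≡ h i) → sumTo n g ≡ sumTo n h
sumTo-cong zero e = e 0
sumTo-cong (suc n) e = cong₂ _+_ (sumTo-cong n e) (e (suc n))

sumTo-zero : ∀ n {g : ℕ → ℕ} → (∀ i → i ≤ n → g i ≡ 0) → sumTo n g ≡ 0
sumTo-zero zero e = e 0 z≤n
sumTo-zero (suc n) e = cong₂ _+_ (sumTo-zero n (λ i le → e i (m≤n⇒m≤1+n le))) (e (suc n) ≤-refl)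

sumTo-pick : ∀ n {g : ℕ → ℕ} k → k ≤ n → (∀ i → i ≤ n → i ≢ k → g i ≡ 0) → sumTo n g ≡ g k
sumTo-pick zero zero _ _ = refl
sumTo-pick (suc n) {g} k le off with k ≟ suc n
... | yes refl = cong (_+ g (suc n)) (sumTo-zero n λ i le' → off i (m≤n⇒m≤1+n le') (<⇒≢ (s≤s le')))
... | no ne = trans (cong₂ _+_ (sumTo-pick n k (≤-pred (≤∧≢⇒< le ne)) (λ i le' → off i (m≤n⇒m≤1+n le'))) (off (suc n) ≤-refl (≢-sym ne)))
                (+-identityʳ (g k))

-- `X` and `Y` are definitionally `monomial 1 0` and `monomial 0 1`, so their products become shifts
-- of the exponents.
monomial : ℕ → ℕ → Poly2
monomial u v f b = ind ((f ≡ᵇ u) ∧ (b ≡ᵇ v))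

monomial-off-x : ∀ {u v f b} → f ≢ u → monomial u v f b ≡ 0
monomial-off-x ne rewrite ≢⇒≡ᵇ-false ne = refl

monomial-off-y : ∀ {u v} f {b} → b ≢ v → monomial u v f b ≡ 0
monomial-off-y {u} f ne rewrite ≢⇒≡ᵇ-false ne = cong ind (∧-zeroʳ (f ≡ᵇ u))

monomial-on : ∀ u v → monomial u v u v ≡ 1
monomial-on u v rewrite ≡ᵇ-refl u | ≡ᵇ-refl v = refl

monomial-⊗ : ∀ u v p {f b} → u ≤ f → v ≤ b → (monomial u v ⊗ p) f b ≡ p (f ∸ u) (b ∸ v)
monomial-⊗ u v p {f} {b} uf vb = trans
  (sumTo-pick f u uf λ i _ ne → sumTo-zero b λ j _ → cong (_* p (f ∸ i) (b ∸ j)) (monomial-off-x {u} {v} {i} {j} ne))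
  (trans (sumTo-pick b v vb λ j _ ne → cong (_* p (f ∸ u) (b ∸ j)) (monomial-off-y {u} {v} u ne))
    (trans (cong (_* p (f ∸ u) (b ∸ v)) (monomial-on u v)) (+-identityʳ _)))

monomial-⊗-x : ∀ u v p {f b} → f < u → (monomial u v ⊗ p) f b ≡ 0
monomial-⊗-x u v p {f} {b} fu = sumTo-zero f λ i le → sumTo-zero b λ j _ →
  cong (_* p (f ∸ i) (b ∸ j)) (monomial-off-x {u} {v} {i} {j} (<⇒≢ (≤-<-trans le fu)))

monomial-⊗-y : ∀ u v p {f b} → b < v → (monomial u v ⊗ p) f b ≡ 0
monomial-⊗-y u v p {f} {b} bv = sumTo-zero f λ i _ → sumTo-zero b λ j le →
  cong (_* p (f ∸ i) (b ∸ j)) (monomial-off-y {u} {v} i (<⇒≢ (≤-<-trans le bv)))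

⊗-congˡ : ∀ {p p' q} → (∀ i j → p i j ≡ p' i j) → ∀ f b → (p ⊗ q) f b ≡ (p' ⊗ q) f b
⊗-congˡ {q = q} e f b = sumTo-cong f λ i → sumTo-cong b λ j → cong (_* q (f ∸ i) (b ∸ j)) (e i j)

X⊗Y : ∀ f b → (X ⊗ Y) f b ≡ monomial 1 1 f b
X⊗Y zero b = monomial-⊗-x 1 0 Y {0} {b} (s≤s z≤n)
X⊗Y (suc f) b = monomial-⊗ 1 0 Y {suc f} {b} (s≤s z≤n) z≤n

XY-suc : ∀ p f b → (X ⊗ Y ⊗ p) (suc f) (suc b) ≡ p f b
XY-suc p f b = trans (⊗-congˡ {q = p} X⊗Y (suc f) (suc b)) (monomial-⊗ 1 1 p (s≤s z≤n) (s≤s z≤n))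

XY-zero-x : ∀ p b → (X ⊗ Y ⊗ p) 0 b ≡ 0
XY-zero-x p b = trans (⊗-congˡ {q = p} X⊗Y 0 b) (monomial-⊗-x 1 1 p {0} {b} (s≤s z≤n))

XY-zero-y : ∀ p f → (X ⊗ Y ⊗ p) f 0 ≡ 0
XY-zero-y p f = trans (⊗-congˡ {q = p} X⊗Y f 0) (monomial-⊗-y 1 1 p {f} (s≤s z≤n))

-- The first factor contains only powers of $x$ and the second only powers of $y$, so the
-- convolution keeps the single term `i = f`, `j = 0`.
Dx⊗Dy : ∀ a b c d f g → (Dx a b ⊗ Dy c d) f g ≡ delannoy a b f * delannoy c d g
Dx⊗Dy a b c d f g = trans
  (sumTo-pick f f ≤-refl λ i le ne → sumTo-zero g λ j _ →
    trans (cong (λ x → Dx a b i j * (ind x * delannoy c d (g ∸ j)))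
      (≢⇒≡ᵇ-false {f ∸ i} {0} (λ e → ne (≤-antisym le (m∸n≡0⇒m≤n e))))) (*-zeroʳ (Dx a b i j)))
  (trans (sumTo-pick g 0 z≤n λ j _ ne → cong (λ x → ind x * delannoy a b f * Dy c d (f ∸ f) (g ∸ j)) (≢⇒≡ᵇ-false ne))
    (cong₂ _*_ (+-identityʳ (delannoy a b f))
      (trans (cong (λ x → ind (x ≡ᵇ 0) * delannoy c d g) (n∸n≡0 f)) (+-identityʳ (delannoy c d g)))))

pure : ℕ → ℕ → ℕ → Poly2
pure n a b = ind (a + b + 1 ≡ᵇ n) · (X ⊗ Dx a b ⊕ Y ⊗ Dy a b)

pure-forward : ∀ n a b f → pure n a b (suc f) 0 ≡ ind (a + b + 1 ≡ᵇ n) * delannoy a b f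
pure-forward n a b f = cong (ind (a + b + 1 ≡ᵇ n) *_) (trans
  (cong₂ _+_ (monomial-⊗ 1 0 (Dx a b) {suc f} {0} (s≤s z≤n) z≤n) (monomial-⊗-y 0 1 (Dy a b) {suc f} {0} (s≤s z≤n)))
  (trans (+-identityʳ _) (+-identityʳ _)))

pure-backward : ∀ n a b f → pure n a b 0 (suc f) ≡ ind (a + b + 1 ≡ᵇ n) * delannoy a b f
pure-backward n a b f = cong (ind (a + b + 1 ≡ᵇ n) *_) (trans
  (cong₂ _+_ (monomial-⊗-x 1 0 (Dx a b) {0} {suc f} (s≤s z≤n)) (monomial-⊗ 0 1 (Dy a b) {0} {suc f} z≤n (s≤s z≤n)))
  (+-identityʳ _))

pure-mixed : ∀ n a b f g → pure n a b (suc f) (suc g) ≡ 0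
pure-mixed n a b f g = trans (cong (ind (a + b + 1 ≡ᵇ n) *_)
  (cong₂ _+_ (monomial-⊗ 1 0 (Dx a b) {suc f} {suc g} (s≤s z≤n) z≤n) (monomial-⊗ 0 1 (Dy a b) {suc f} {suc g} z≤n (s≤s z≤n))))
  (*-zeroʳ (ind (a + b + 1 ≡ᵇ n)))

pure-empty : ∀ n a b → pure n a b 0 0 ≡ 0
pure-empty n a b = *-zeroʳ (ind (a + b + 1 ≡ᵇ n))

junctions : ℕ → ℕ → ℕ → ℕ → ℕ → ℕ
junctions n a' b' a'' b'' =
  ind (a' + b' + a'' + b'' + 2 + 1 ≡ᵇ n) * C₁ a' b' a'' b'' + ind (a' + b' + a'' + b'' + 2 ≡ᵇ n) * C₀ a' b' a'' b''

mixed : ℕ → Poly2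
mixed n = ΣP n λ a' → ΣP n λ b' → ΣP n λ a'' → ΣP n λ b'' → junctions n a' b' a'' b'' · (Dx a' b' ⊗ Dy a'' b'')

-- For positive `n` the constant term reduces to 0, and everything multiplied by `X ⊗ Y` vanishes in
-- degree 0 of $y$. The shift from `suc f` to `f` is the factor `X`.
rhsZ-forward : ∀ m f → let n = suc m in rhsZ n (suc f) 0 ≡
  sumTo n λ a → sumTo n λ b → ind (a + b + 1 ≡ᵇ n) * delannoy a b f
rhsZ-forward m f = trans (cong₂ _+_
  (sumTo-cong (suc m) λ a → sumTo-cong (suc m) λ b → pure-forward (suc m) a b f) (XY-zero-y (mixed (suc m)) (suc f))) (+-identityʳ _)

rhsZ-backward : ∀ m f → let n = suc m in rhsZ n 0 (suc f) ≡
  sumTo n λ a → sumTo n λ b → ind (a + b + 1 ≡ᵇ n) * delannoy a b f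
rhsZ-backward m f = trans (cong₂ _+_
  (sumTo-cong (suc m) λ a → sumTo-cong (suc m) λ b → pure-backward (suc m) a b f) (XY-zero-x (mixed (suc m)) (suc f))) (+-identityʳ _)

rhsZ-mixed : ∀ m f g → let n = suc m in rhsZ n (suc f) (suc g) ≡
  sumTo n λ a' → sumTo n λ b' → sumTo n λ a'' → sumTo n λ b'' →
    junctions n a' b' a'' b'' * (delannoy a' b' f * delannoy a'' b'' g)
rhsZ-mixed m f g = cong₂ _+_
  (sumTo-zero (suc m) λ a _ → sumTo-zero (suc m) λ b _ → pure-mixed (suc m) a b f g)
  (trans (XY-suc (mixed (suc m)) f g)
    (sumTo-cong (suc m) λ a' → sumTo-cong (suc m) λ b' → sumTo-cong (suc m) λ a'' → sumTo-cong (suc m) λ b'' →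
      cong (junctions (suc m) a' b' a'' b'' *_) (Dx⊗Dy a' b' a'' b'' f g)))

rhsZ-empty : ∀ m → rhsZ (suc m) 0 0 ≡ 0
rhsZ-empty m = cong₂ _+_ (sumTo-zero (suc m) λ a _ → sumTo-zero (suc m) λ b _ → pure-empty (suc m) a b)
  (XY-zero-x (mixed (suc m)) 0)

countB≤length : {A : Set} (p : A → Bool) (xs : List A) → countB p xs ≤ length xs
countB≤length p [] = z≤n
countB≤length p (x ∷ xs) with p x
... | true = s≤s (countB≤length p xs)
... | false = m≤n⇒m≤1+n (countB≤length p xs)

-- Justifies cutting the sums off at `n`: an index `k` stands for `k + 1` letters of one kind among
-- `n + 1` positions.
letters-≤ : ∀ p {n k} (W : Vec Letter (suc n)) → countB p (toList W) ≡ suc k → k ≤ n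
letters-≤ p {n} W e = ≤-pred (≤-trans (≤-reflexive (sym e)) (≤-trans (countB≤length p (toList W)) (≤-reflexive (length-toList W))))

-- Counting codes and comparing them with faces

module _ (r s : Matching) (m : ℕ) where

  private
    n = suc m

  open Coding r s n

  HasSize : ℕ → ℕ → Code → Set
  HasSize f b c = trailLength (proj₁ (proj₂ c)) ≡ f × trailLength (proj₂ (proj₂ c)) ≡ b

  FittingCounts : Code → Set
  FittingCounts (W , m₁ , m₂) = Valid (toList W) ×
    TrailEndsAt (countB fwdTail (toList W)) (countB fwdHead (toList W)) m₁ ×
    TrailEndsAt (countB bwdTail (toList W)) (countB bwdHead (toList W)) m₂

  fitting⇒counts : ∀ {c} → Fitting c → FittingCounts c
  fitting⇒counts {W , m₁ , m₂} (v , d , d') = v ,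
    subst₂ (λ p q → TrailEndsAt p q m₁) (length-positions cross fwdTail W) (length-positions r fwdHead W) (TrailFits⇒EndsAt m₁ d) ,
    subst₂ (λ p q → TrailEndsAt p q m₂) (length-positions cross bwdTail W) (length-positions s bwdHead W) (TrailFits⇒EndsAt m₂ d')

  counts⇒fitting : ∀ {c} → FittingCounts c → Fitting c
  counts⇒fitting {W , m₁ , m₂} (v , d , d') = v ,
    EndsAt⇒TrailFits (T₁ W) (H₁ W) m₁
      (subst₂ (λ p q → TrailEndsAt p q m₁) (sym (length-positions cross fwdTail W)) (sym (length-positions r fwdHead W)) d) ,
    EndsAt⇒TrailFits (T₂ W) (H₂ W) m₂
      (subst₂ (λ p q → TrailEndsAt p q m₂) (sym (length-positions cross bwdTail W)) (sym (length-positions s bwdHead W)) d')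

  IsCode : ℕ → ℕ → Code → Set
  IsCode f b c = Fitting c × HasSize f b c

  count-code-forward : ∀ f → Counts (IsCode (suc f) 0) (rhsZ n (suc f) 0)
  count-code-forward f = subst (Counts _) (sym (rhsZ-forward m f))
    (counts-image (λ (W , w) → W , just w , nothing) (λ { _ _ refl → refl }) to from
      (counts-sum (λ a x → ∃ λ b → b ≤ n × Data a b x) _ n
        (λ a _ → counts-sum (Data a) _ n
          (λ b _ → counts-× (count-word-forward a b n) (count-path a b f))
          λ { (_ , _ , refl) (_ , _ , refl) → refl })
        λ { (_ , _ , _ , _ , refl) (_ , _ , _ , _ , refl) → refl }))
    where
    Data : ℕ → ℕ → Vec Letter (suc n) × List Step → Set
    Data a b (W , w) = Word (suc a) (suc b) 0 0 W × Path a b f w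
    to : ∀ {x} → (∃ λ a → a ≤ n × ∃ λ b → b ≤ n × Data a b x) → IsCode (suc f) 0 (proj₁ x , just (proj₂ x) , nothing)
    to {W , w} (_ , _ , _ , _ , (v , e₁ , e₂ , e₃ , e₄) , refl , refl) = counts⇒fitting (v , (e₁ , e₂) , (e₃ , e₄)) , refl , refl
    from : ∀ {c} → IsCode (suc f) 0 c → ∃ λ x → (∃ λ a → a ≤ n × ∃ λ b → b ≤ n × Data a b x) × (proj₁ x , just (proj₂ x) , nothing) ≡ c
    from {W , just w , nothing} (fit , e , e') =
      let v , (e₁ , e₂) , (e₃ , e₄) = fitting⇒counts fit
      in (W , w) , (_ , letters-≤ fwdTail W e₁ , _ , letters-≤ fwdHead W e₂ , (v , e₁ , e₂ , e₃ , e₄) , suc-injective e , refl) , refl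

  count-code-backward : ∀ b → Counts (IsCode 0 (suc b)) (rhsZ n 0 (suc b))
  count-code-backward k = subst (Counts _) (sym (rhsZ-backward m k))
    (counts-image (λ (W , w) → W , nothing , just w) (λ { _ _ refl → refl }) to from
      (counts-sum (λ a x → ∃ λ b → b ≤ n × Data a b x) _ n
        (λ a _ → counts-sum (Data a) _ n
          (λ b _ → counts-× (count-word-backward a b n) (count-path a b k))
          λ { (_ , _ , refl) (_ , _ , refl) → refl })
        λ { (_ , _ , _ , _ , refl) (_ , _ , _ , _ , refl) → refl }))
    where
    Data : ℕ → ℕ → Vec Letter (suc n) × List Step → Set
    Data a b (W , w) = Word 0 0 (suc a) (suc b) W × Path a b k w
    to : ∀ {x} → (∃ λ a → a ≤ n × ∃ λ b → b ≤ n × Data a b x) → IsCode 0 (suc k) (proj₁ x , nothing , just (proj₂ x))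
    to {W , w} (_ , _ , _ , _ , (v , e₁ , e₂ , e₃ , e₄) , refl , refl) = counts⇒fitting (v , (e₁ , e₂) , (e₃ , e₄)) , refl , refl
    from : ∀ {c} → IsCode 0 (suc k) c → ∃ λ x → (∃ λ a → a ≤ n × ∃ λ b → b ≤ n × Data a b x) × (proj₁ x , nothing , just (proj₂ x)) ≡ c
    from {W , nothing , just w} (fit , e , e') =
      let v , (e₁ , e₂) , (e₃ , e₄) = fitting⇒counts fit
      in (W , w) , (_ , letters-≤ bwdTail W e₃ , _ , letters-≤ bwdHead W e₄ , (v , e₁ , e₂ , e₃ , e₄) , suc-injective e' , refl) , refl

  -- The four summation indices are the coordinates of the endpoints of the two paths. They are
  -- determined by the code, which makes the nested sums disjoint unions.
  count-code-mixed : ∀ f b → Counts (IsCode (suc f) (suc b)) (rhsZ n (suc f) (suc b))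
  count-code-mixed f g = subst (Counts _) (sym (rhsZ-mixed m f g))
    (counts-image (λ (W , w , w') → W , just w , just w') (λ { _ _ refl → refl }) to from
      (counts-sum Data₁ _ n
        (λ a' _ → counts-sum (Data₂ a') _ n
          (λ b' _ → counts-sum (Data₃ a' b') _ n
            (λ a'' _ → counts-sum (Data₄ a' b' a'') _ n
              (λ b'' _ → counts-× (count-word a' b' a'' b'' n) (counts-× (count-path a' b' f) (count-path a'' b'' g)))
              λ { (_ , _ , _ , refl) (_ , _ , _ , refl) → refl })
            λ { (_ , _ , _ , _ , _ , refl) (_ , _ , _ , _ , _ , refl) → refl })
          λ { (_ , _ , _ , _ , _ , (_ , refl) , _) (_ , _ , _ , _ , _ , (_ , refl) , _) → refl })
        λ { (_ , _ , _ , _ , _ , _ , _ , (_ , refl) , _) (_ , _ , _ , _ , _ , _ , _ , (_ , refl) , _) → refl }))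
    where
    Data₄ : ℕ → ℕ → ℕ → ℕ → Vec Letter (suc n) × List Step × List Step → Set
    Data₄ a' b' a'' b'' (W , w , w') = Word (suc a') (suc b') (suc a'') (suc b'') W × Path a' b' f w × Path a'' b'' g w'
    Data₃ : ℕ → ℕ → ℕ → Vec Letter (suc n) × List Step × List Step → Set
    Data₃ a' b' a'' x = ∃ λ b'' → b'' ≤ n × Data₄ a' b' a'' b'' x
    Data₂ : ℕ → ℕ → Vec Letter (suc n) × List Step × List Step → Set
    Data₂ a' b' x = ∃ λ a'' → a'' ≤ n × Data₃ a' b' a'' x
    Data₁ : ℕ → Vec Letter (suc n) × List Step × List Step → Set
    Data₁ a' x = ∃ λ b' → b' ≤ n × Data₂ a' b' x
    to : ∀ {x} → (∃ λ a' → a' ≤ n × Data₁ a' x) → IsCode (suc f) (suc g) (proj₁ x , just (proj₁ (proj₂ x)) , just (proj₂ (proj₂ x)))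
    to (_ , _ , _ , _ , _ , _ , _ , _ , (v , e₁ , e₂ , e₃ , e₄) , (refl , refl) , (refl , refl)) =
      counts⇒fitting (v , (e₁ , e₂) , (e₃ , e₄)) , refl , refl
    from : ∀ {c} → IsCode (suc f) (suc g) c →
      ∃ λ x → (∃ λ a' → a' ≤ n × Data₁ a' x) × (proj₁ x , just (proj₁ (proj₂ x)) , just (proj₂ (proj₂ x))) ≡ c
    from {W , just w , just w'} (fit , e , e') =
      let v , (e₁ , e₂) , (e₃ , e₄) = fitting⇒counts fit
      in (W , w , w') , (_ , letters-≤ fwdTail W e₁ , _ , letters-≤ fwdHead W e₂ , _ , letters-≤ bwdTail W e₃ , _ , letters-≤ bwdHead W e₄ ,
           (v , e₁ , e₂ , e₃ , e₄) , (suc-injective e , refl) , (suc-injective e' , refl)) , refl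

  -- A code without arrows would leave the first vertex uncovered.
  count-code-empty : Counts (IsCode 0 0) (rhsZ n 0 0)
  count-code-empty = subst (Counts _) (sym (rhsZ-empty m))
    (counts-∅ λ { {W , nothing , nothing} (fit , _) → no-arrows (proj₁ (proj₂ (Decoding.codeArrows-covering {c = W , nothing , nothing} fit zero))) })
    where
    no-arrows : ∀ {a : Arrow n} → ¬ (a ∈ [])
    no-arrows ()

  count-code : ∀ f b → Counts (IsCode f b) (rhsZ n f b)
  count-code zero zero = count-code-empty
  count-code zero (suc b) = count-code-backward b
  count-code (suc f) zero = count-code-forward f
  count-code (suc f) (suc b) = count-code-mixed f b

  module _ {R : RuleSet} (ok : Allowed TTHH r) (ok' : Allowed HHTT s) (R≗ : (t : PairType) → R t ≡ rules r s t) where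

    faceTest : ℕ → ℕ → List (Arrow n) → Bool
    faceTest f b σ = isClique R σ ∧ saturated n σ ∧ (countB forward? σ ≡ᵇ f) ∧ (countB backward? σ ≡ᵇ b)

    IsFace : ℕ → ℕ → List (Arrow n) → Set
    IsFace f b σ = σ ∈ sublists (arrows n) × T (faceTest f b σ)

    code⇒face : ∀ {f b c} → IsCode f b c → ∃ λ σ → IsFace f b σ × Represents c σ
    code⇒face {f} {b} {c} (fit , e , e') with code-represents c fit
    ... | σ , ρ@(σ∈ , g , h) = σ , (σ∈ , Equivalence.from T-∧
      ( agree⇒clique ok ok' R≗ (sublists-AllPairs (arrows-unique n) σ∈) (codeArrows-proper ∘ g) (λ i j → codeArrows-agree (g i) (g j))
      , Equivalence.from (T-∧ {saturated n σ})
        ( covering⇒saturated m σ (λ k → let a , i , p = codeArrows-covering k in a , h i , p)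
        , Equivalence.from T-∧
          ( ≡⇒≡ᵇ _ f (trans (forward-count fit ρ) e)
          , ≡⇒≡ᵇ _ b (trans (backward-count fit ρ) e'))))) , ρ
      where open Decoding fit

    face⇒code : ∀ {f b σ} → IsFace f b σ → ∃ λ c → IsCode f b c × Represents c σ
    face⇒code {f} {b} {σ} (σ∈ , t) =
      let t₁ , t' = Equivalence.to (T-∧ {isClique R σ}) t
          t₂ , t'' = Equivalence.to (T-∧ {saturated n σ}) t'
          t₃ , t₄ = Equivalence.to (T-∧ {countB forward? σ ≡ᵇ f}) t''
          c , fit , ρ = Encoding.face-represented σ∈
            (clique⇒agree ok ok' R≗ (λ i → ∈-arrows⁻ (sublists-⊆ σ∈ i)) t₁) (saturated⇒covering m σ t₂)
      in c , (fit , trans (sym (forward-count fit ρ)) (≡ᵇ⇒≡ _ f t₃) , trans (sym (backward-count fit ρ)) (≡ᵇ⇒≡ _ b t₄)) , ρ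

    satFaces≡rhsZ : ∀ f b → satFaces R n f b ≡ rhsZ n f b
    satFaces≡rhsZ f b = sym (counts-correspond Represents (count-code f b)
      (counts-boolFilter (faceTest f b) (sublists (arrows n)) (sublists-unique (arrows-unique n)))
      code⇒face face⇒code
      (λ {c} {c'} (fit , _) (fit' , _) → represents-injective {c} {c'} fit fit')
      (λ {c} _ _ → represents-functional {c}))

-- With no arrows the only face is the empty one. On the right every other summand has a positive
-- power of $z$, so its indicator is false and only the constant 1 remains.
satFaces₀≡rhsZ : ∀ R f b → satFaces R 0 f b ≡ rhsZ 0 f b
satFaces₀≡rhsZ R zero zero = refl
satFaces₀≡rhsZ R zero (suc b) = sym (XY-zero-x (mixed 0) (suc b))
satFaces₀≡rhsZ R (suc f) zero = sym (XY-zero-y (mixed 0) (suc f))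
satFaces₀≡rhsZ R (suc f) (suc b) = sym (XY-suc (mixed 0) f b)

theorem8p1 : (R : RuleSet) → ValidRuleSet R →
    R THTH ≡ nest → R HTHT ≡ nest → R HTTH ≡ cross → R THHT ≡ cross →
    (n f b : ℕ) → satFaces R n f b ≡ rhsZ n f b
theorem8p1 R ok thth htht htth thht zero f b = satFaces₀≡rhsZ R f b
theorem8p1 R ok thth htht htth thht (suc m) f b =
  -- The two types left open become the parameters; validity of the rule set restricts each of them
  -- to nesting or crossing.
  satFaces≡rhsZ (R TTHH) (R HHTT) m (ok TTHH) (ok HHTT) R≗ f b
  where
  R≗ : ∀ t → R t ≡ rules (R TTHH) (R HHTT) t
  R≗ THTH = thth
  R≗ HTHT = htht
  R≗ THHT = thht
  R≗ HTTH = htth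
  R≗ TTHH = refl
  R≗ HHTT = refl
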